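{- Let $N$ be an integer greater than $1$, and let $C_N=(P_1)-(P_N)$ on $X_0(N)$. Then $$\mathsf{GCD}(C_N)=\mathfrak{g}(N)\quad\text{and}\quad\mathfrak{h}(C_N)=\mathfrak{h}(N),$$ where $\mathfrak{g}$ and $\mathfrak{h}$ are defined as follows: 1. $\mathfrak{g}(1)=0$; 2. $\mathfrak{g}(N)=\gcd(N+(-1)^{t-1},\ p_i^2-1:1\le i\le t)$ if $N=\prod_{i=1}^tp_i$ is squarefree; 3. $\mathfrak{g}(N)=\gcd(p,\mathfrak{g}(M))$ if $N=Mp^2$ with $p$ prime, $\gcd(M,p)=1$ and $M$ squarefree; 4. $\mathfrak{g}(N)=1$ otherwise. Also, $\mathfrak{h}(N)=2$ if one of the following holds, and $\mathfrak{h}(N)=1$ otherwise: 1. $N=p$ for a prime $p$; 2. $N=2^r$ for an odd integer $r$; 3. $N=pq$ for two distinct odd primes $p$ and $q$ such that $\mathrm{val}_2(p-1)=\mathrm{val}_2(q-1)$ and $\mathrm{val}_2(p+1)=\mathrm{val}_2(q+1)$; 4. $N=4p$ for a prime $p$ congruent to $1$ modulo $4$.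
   Context: For $d\mid N$, a cusp of $X_0(N)$ is of level $d$ if it is represented by $x/d$ with $\gcd(x,d)=1$; $(P_d)$ is the sum of all cusps of level $d$, each with multiplicity one (so $(P_1)$ is the cusp $0$ and $(P_N)$ is the cusp $\infty$). For a prime $p$ and $r\ge1$, with $m(j)=\min(j,r-j)$, let $\Upsilon(p^r)$ be the matrix indexed by divisors of $p^r$ with $\Upsilon(p^r)_{p^ip^j}=p$ if $i=j\in\{0,r\}$; $p^{m(j)-1}(p^2+1)$ if $1\le i=j\le r-1$; $-p^{m(j)}$ if $|i-j|=1$; $0$ if $|i-j|\ge2$. For $N=\prod p_i^{r_i}$, $\delta=\prod p_i^{e_i}$, $d=\prod p_i^{f_i}$, put $\Upsilon(N)_{\delta d}=\prod_i\Upsilon(p_i^{r_i})_{p_i^{e_i}p_i^{f_i}}$. For nonzero $C=\sum_{d\mid N} a_d(P_d)$ ($a_d\in\mathbf{Z}$): $V(C)_\delta=\sum_{d\mid N}\Upsilon(N)_{\delta d}\,a_d$; $\mathsf{GCD}(C)$ is the greatest common divisor of the entries $V(C)_\delta$, $\delta\mid N$; $\mathbb{V}(C)=\mathsf{GCD}(C)^{ -1}V(C)$; for a prime $p$, $\mathsf{Pw}_p(C)=\sum_{\delta\mid N,\ \mathrm{val}_p(\delta)\ \text{odd}}\mathbb{V}(C)_\delta$; $\mathfrak{h}(C)=1$ if $\mathsf{Pw}_p(C)$ is even for all primes $p$, and $\mathfrak{h}(C)=2$ otherwise. -}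

module Defs where

open import Data.Bool.Base using (if_then_else_; _∨_)
open import Data.Integer.Base as ℤ using (ℤ; +_; 0ℤ; 1ℤ; -1ℤ)
import Data.Integer.Divisibility as ℤ
open import Data.List.Base using (List; []; _∷_; filter; foldr; length; map; upTo)
open import Data.List.Properties using (filter-none)
import Data.List.Relation.Unary.All as All
import Data.List.Relation.Unary.All.Properties as All
open import Data.Nat.Base
open import Data.Nat.Coprimality using (Coprime; coprime?)
open import Data.Nat.DivMod using (_%_)
open import Data.Nat.Divisibility
open import Data.Nat.GCD using (gcd)
open import Data.Nat.Primality using (Prime; prime?; prime⇒nonZero; prime⇒nonTrivial)
open import Data.Nat.Properties
open import Data.Product.Base using (∃-syntax; _×_; _,_)
open import Data.Sum.Base using (_⊎_)
open import Function.Base using (_∘_)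
open import Relation.Binary.PropositionalEquality
  using (_≡_; _≢_; refl; sym; trans; cong; subst)
open import Relation.Nullary.Decidable
  using (Dec; yes; no; does; map′; ¬?; _×-dec_; _⊎-dec_; _→-dec_)
open import Relation.Nullary.Negation using (¬_; contradiction)

------------------------------------------------------------------------
-- Elementary arithmetic

sumℤ prodℤ : List ℤ → ℤ
sumℤ  = foldr ℤ._+_ 0ℤ
prodℤ = foldr ℤ._*_ 1ℤ

gcdℤ : List ℤ → ℕ
gcdℤ = foldr (λ i g → gcd ℤ.∣ i ∣ g) 0

-- Only for N ≥ 1; the same holds for primeDivisors.
divisors : ℕ → List ℕ
divisors N = filter (_∣? N) (upTo (suc N))

primeDivisors : ℕ → List ℕ
primeDivisors N = filter prime? (divisors N)

-- The largest k ≤ b with p ^ k ∣ n.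
largestExponent : (p n b : ℕ) → ℕ
largestExponent p n zero    = 0
largestExponent p n (suc b) =
  if does (p ^ suc b ∣? n) then suc b else largestExponent p n b

-- The p-adic valuation of n, for p ≥ 2 and n ≥ 1: the bound n on the exponent
-- is harmless because p ^ k ∣ n forces k < p ^ k ≤ n.
val : (p n : ℕ) → ℕ
val p n = largestExponent p n n

Squarefree : ℕ → Set
Squarefree n = ∀ p → Prime p → p ^ 2 ∤ n

------------------------------------------------------------------------
-- Cuspidal divisors and the matrix Υ

-- The divisor Σ_{d ∣ N} a_d (P_d) on X₀(N) is given by its coefficients d ↦ a_d.
-- The (P_d) have disjoint non-empty supports, so the coefficients are determined
-- by the divisor. Values at arguments not dividing N are never used.
CuspidalDivisor : Set
CuspidalDivisor = ℕ → ℤ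

infixl 6 _⊖ᶜ_

_⊖ᶜ_ : CuspidalDivisor → CuspidalDivisor → CuspidalDivisor
(C ⊖ᶜ D) d = C d ℤ.- D d

P : ℕ → CuspidalDivisor
P d e = if does (d ≟ e) then 1ℤ else 0ℤ

-- The entry of Υ(p ^ r) at (p ^ i , p ^ j).
Υ-primePower : (p r i j : ℕ) → ℤ
Υ-primePower p r i j =
  if does (i ≟ j)
  then (if does (i ≟ 0) ∨ does (i ≟ r)
        then + p
        else + (p ^ (m ∸ 1) * (p ^ 2 + 1)))
  else (if does (∣ i - j ∣ ≟ 1)
        then ℤ.- (+ (p ^ m))
        else 0ℤ)
  where
  m : ℕ
  m = j ⊓ (r ∸ j)

Υ : (N δ d : ℕ) → ℤ
Υ N δ d =
  prodℤ (map (λ p → Υ-primePower p (val p N) (val p δ) (val p d)) (primeDivisors N))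

------------------------------------------------------------------------
-- Invariants of a cuspidal divisor of level N

V : ℕ → CuspidalDivisor → ℕ → ℤ
V N C δ = sumℤ (map (λ d → Υ N δ d ℤ.* C d) (divisors N))

GCD : ℕ → CuspidalDivisor → ℕ
GCD N C = gcdℤ (map (V N C) (divisors N))

-- Division with the convention i /₀ 0 = 0.
infixl 7 _/₀_

_/₀_ : ℤ → ℕ → ℤ
i /₀ zero      = 0ℤ
i /₀ n@(suc _) = i ℤ./ℕ n

-- For δ ∣ N the division is exact. Since Υ(N) is nonsingular, GCD N C is zero
-- only if C = 0, so the convention above is not used for non-zero C.
𝕍 : ℕ → CuspidalDivisor → ℕ → ℤ
𝕍 N C δ = V N C δ /₀ GCD N C

Pw : ℕ → CuspidalDivisor → ℕ → ℤ
Pw N C p = sumℤ (map (𝕍 N C) (filter (λ δ → ¬? (2 ∣? val p δ)) (divisors N)))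

AllPwEven : ℕ → CuspidalDivisor → Set
AllPwEven N C = ∀ p → Prime p → + 2 ℤ.∣ Pw N C p

private
  largestExponent-small : ∀ {p n} → n < p → ∀ b → b ≤ n → largestExponent p n b ≡ 0
  largestExponent-small n<p zero    _ = refl
  largestExponent-small {p} {n} n<p (suc b) b<n with p ^ suc b ∣? n
  ... | no  _   = largestExponent-small n<p b (<⇒≤ b<n)
  ... | yes q∣n = contradiction q∣n (>⇒∤ {{>-nonZero (<-≤-trans z<s b<n)}}
                    (<-≤-trans n<p (m≤m*n p (p ^ b) {{m^n≢0 p b {{>-nonZero (≤-<-trans z≤n n<p)}}}})))

  -- A prime p > N divides no divisor of N, so the sum defining Pw N C p is empty.
  Pw-large : ∀ N C {p} → N < p → Pw N C p ≡ 0ℤ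
  Pw-large N C {p} N<p = cong (sumℤ ∘ map (𝕍 N C))
    (filter-none (λ δ → ¬? (2 ∣? val p δ))
      (All.filter⁺ (_∣? N) (All.map even (All.all-upTo (suc N)))))
    where
    even : ∀ {δ} → δ < suc N → ¬ (2 ∤ val p δ)
    even {δ} δ<1+N odd = odd (subst (2 ∣_)
      (sym (largestExponent-small (<-≤-trans δ<1+N N<p) δ ≤-refl)) (2 ∣0))

allPwEven? : ∀ N C → Dec (AllPwEven N C)
allPwEven? N C =
  map′ extend restrict (allUpTo? (λ p → prime? p →-dec (2 ∣? ℤ.∣ Pw N C p ∣)) (suc N))
  where
  Bounded : Set
  Bounded = ∀ {p} → p < suc N → Prime p → + 2 ℤ.∣ Pw N C p

  extend : Bounded → AllPwEven N C
  extend h p pr with p <? suc N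
  ... | yes p≤N = h p≤N pr
  ... | no  p≰N = subst (+ 2 ℤ.∣_) (sym (Pw-large N C (≮⇒≥ p≰N))) (2 ∣0)

  restrict : AllPwEven N C → Bounded
  restrict h {p} _ = h p

𝔥ᶜ : ℕ → CuspidalDivisor → ℕ
𝔥ᶜ N C = if does (allPwEven? N C) then 1 else 2

C⟨_⟩ : ℕ → CuspidalDivisor
C⟨ N ⟩ = P 1 ⊖ᶜ P N

------------------------------------------------------------------------
-- The function 𝔤

squarefree? : ∀ n → .{{NonZero n}} → Dec (Squarefree n)
squarefree? n = map′ extend (λ h {p} _ → h p)
  (allUpTo? (λ p → prime? p →-dec ¬? (p ^ 2 ∣? n)) (suc n))
  where
  extend : (∀ {p} → p < suc n → Prime p → p ^ 2 ∤ n) → Squarefree n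
  extend h p pr p²∣n = h (s≤s (∣⇒≤ (∣-trans (m∣m*n (p ^ 1)) p²∣n))) pr p²∣n

𝔤-squarefree : ℕ → ℕ
𝔤-squarefree 1 = 0
𝔤-squarefree N =
  gcdℤ ((+ N ℤ.+ -1ℤ ℤ.^ (t ∸ 1)) ∷ map (λ p → + (p ^ 2) ℤ.- 1ℤ) (primeDivisors N))
  where
  t : ℕ
  t = length (primeDivisors N)

SquarefreeTimesSquare : ℕ → Set
SquarefreeTimesSquare N =
  ∃[ p ] ∃[ M ] Prime p × N ≡ M * p ^ 2 × Coprime M p × Squarefree M

squarefreeTimesSquare? : ∀ N → .{{NonZero N}} → Dec (SquarefreeTimesSquare N)
squarefreeTimesSquare? N = map′ forget bound
  (anyUpTo? (λ p → anyUpTo? (body? p) (suc N)) (suc N))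
  where
  Body : ℕ → ℕ → Set
  Body p M = Prime p × N ≡ M * p ^ 2 × Coprime M p × Squarefree M

  body? : ∀ p M → Dec (Body p M)
  body? p zero        = no λ { (_ , N≡0 , _) → ≢-nonZero⁻¹ N N≡0 }
  body? p M@(suc _) =
    prime? p ×-dec N ≟ M * p ^ 2 ×-dec coprime? M p ×-dec squarefree? M

  Bounded : Set
  Bounded = ∃[ p ] p < suc N × ∃[ M ] M < suc N × Body p M

  forget : Bounded → SquarefreeTimesSquare N
  forget (p , _ , M , _ , body) = p , M , body

  bound : SquarefreeTimesSquare N → Bounded
  bound (p , M , body@(_ , N≡Mp² , _)) =
    p , s≤s (∣⇒≤ (∣-trans (m∣m*n (p ^ 1)) (divides M N≡Mp²))) ,
    M , s≤s (∣⇒≤ (subst (M ∣_) (sym N≡Mp²) (m∣m*n (p ^ 2)))) , body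

-- Only for N ≥ 1. The recursion 𝔤(M p²) = gcd(p , 𝔤(M)) takes 𝔤 only at
-- squarefree M. In that case p is the unique prime with p² ∣ N, so the value
-- does not depend on which pair (p , M) the search returns.
𝔤 : ℕ → ℕ
𝔤 zero = 0
𝔤 N@(suc _) with squarefree? N
... | yes _ = 𝔤-squarefree N
... | no  _ with squarefreeTimesSquare? N
...   | yes (p , M , _) = gcd p (𝔤-squarefree M)
...   | no  _           = 1

------------------------------------------------------------------------
-- The function 𝔥

IsOddPowerOf2 : ℕ → Set
IsOddPowerOf2 N = ∃[ r ] 2 ∤ r × N ≡ 2 ^ r

IsBalancedProduct : ℕ → Set
IsBalancedProduct N =
  ∃[ p ] ∃[ q ] Prime p × Prime q × p ≢ q × 2 ∤ p × 2 ∤ q × N ≡ p * q ×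
    val 2 (p ∸ 1) ≡ val 2 (q ∸ 1) × val 2 (p + 1) ≡ val 2 (q + 1)

Is4Prime1Mod4 : ℕ → Set
Is4Prime1Mod4 N = ∃[ p ] Prime p × p % 4 ≡ 1 × N ≡ 4 * p

𝔥Is2 : ℕ → Set
𝔥Is2 N = Prime N ⊎ IsOddPowerOf2 N ⊎ IsBalancedProduct N ⊎ Is4Prime1Mod4 N

private
  n<2^n : ∀ n → n < 2 ^ n
  n<2^n zero    = z<s
  n<2^n (suc n) = begin-strict
    suc n          ≡⟨ +-comm 1 n ⟩
    n + 1          <⟨ +-mono-<-≤ (n<2^n n) (m^n>0 2 n) ⟩
    2 ^ n + 2 ^ n  ≡⟨ cong (λ k → 2 ^ n + k) (+-identityʳ (2 ^ n)) ⟨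
    2 ^ suc n      ∎
    where open ≤-Reasoning

isOddPowerOf2? : ∀ N → Dec (IsOddPowerOf2 N)
isOddPowerOf2? N = map′
  (λ { (r , _ , h) → r , h })
  (λ { (r , h@(_ , N≡2^r)) → r , subst (r <_) (sym N≡2^r) (n<2^n r) , h })
  (anyUpTo? (λ r → ¬? (2 ∣? r) ×-dec N ≟ 2 ^ r) N)

isBalancedProduct? : ∀ N → Dec (IsBalancedProduct N)
isBalancedProduct? N = map′
  (λ { (p , _ , q , _ , h) → p , q , h })
  (λ { (p , q , h@(pr , qr , _ , _ , _ , N≡pq , _)) →
       p , s≤s (subst (p ≤_) (sym N≡pq) (m≤m*n p q {{prime⇒nonZero qr}})) ,
       q , s≤s (subst (q ≤_) (sym N≡pq) (m≤n*m q p {{prime⇒nonZero pr}})) , h })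
  (anyUpTo? (λ p → anyUpTo? (λ q →
      prime? p ×-dec prime? q ×-dec ¬? (p ≟ q) ×-dec ¬? (2 ∣? p) ×-dec ¬? (2 ∣? q)
      ×-dec N ≟ p * q ×-dec val 2 (p ∸ 1) ≟ val 2 (q ∸ 1)
      ×-dec val 2 (p + 1) ≟ val 2 (q + 1))
    (suc N)) (suc N))

is4Prime1Mod4? : ∀ N → Dec (Is4Prime1Mod4 N)
is4Prime1Mod4? N = map′
  (λ { (p , _ , h) → p , h })
  (λ { (p , h@(_ , _ , N≡4p)) → p , s≤s (subst (p ≤_) (sym N≡4p) (m≤n*m p 4)) , h })
  (anyUpTo? (λ p → prime? p ×-dec p % 4 ≟ 1 ×-dec N ≟ 4 * p) (suc N))

𝔥Is2? : ∀ N → Dec (𝔥Is2 N)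
𝔥Is2? N =
  prime? N ⊎-dec isOddPowerOf2? N ⊎-dec isBalancedProduct? N ⊎-dec is4Prime1Mod4? N

𝔥 : ℕ → ℕ
𝔥 N = if does (𝔥Is2? N) then 2 else 1

-- Since only the columns of Υ(N) at 1 and N matter, V(C_N)_δ = U_δ - W_δ, where U and W are products of
-- local factors (p, -1, 0, …, 0) and (0, …, 0, -1, p) indexed by the exponent of p in δ.
--
-- For the gcd, write N = M p^r with p ∤ M. If r ≥ 3 some V_δ is ±1, and if r ≥ 2 some V_δ is ±p, while
-- N = M p² with M squarefree gives gcd(p, GCD(C_M)). If N is squarefree, then modulo any c dividing all
-- p² - 1 the local factor of W is -p times that of U, so V_δ ≡ U_δ (1 - (-1)^t N); the entries V_1 and
-- V_1 + p V_p show that nothing else survives.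
--
-- Both local factors sum to p - 1, so summing over δ gives GCD(C_N) Pw_p(C_N) = -(p + 1) ∏_{q ≠ p} (q - 1)
-- if the exponent of p in N is odd, and 0 otherwise. Comparing the powers of 2 on both sides gives 𝔥.
module Submission where

open import Defs
open import Data.Bool.Base using (true; false; if_then_else_)
open import Data.Bool.Properties using (∨-zeroʳ)
open import Data.Integer.Base as ℤ using (ℤ; +_; 0ℤ; 1ℤ; -1ℤ)
import Data.Integer.Properties as ℤ
import Data.Integer.DivMod as ℤ
import Data.Integer.Divisibility.Signed as ℤ
import Data.Integer.Tactic.RingSolver as ℤ-Ring
open import Data.List.Base
  using (List; []; _∷_; _++_; map; filter; upTo; applyUpTo; length; cartesianProduct)
open import Data.List.Membership.Propositional using (_∈_)
open import Data.List.Membership.Propositional.Properties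
open import Data.List.Membership.Propositional.Properties.WithK using (unique∧set⇒bag)
open import Data.List.Properties using (map-∘; upTo-∷ʳ)
open import Data.List.Relation.Binary.BagAndSetEquality using (∼bag⇒↭)
open import Data.List.Relation.Binary.Permutation.Propositional using (_↭_; ↭-sym; ↭⇒↭ₛ)
open import Data.List.Relation.Binary.Permutation.Propositional.Properties
  using (map⁺; ∈-resp-↭; ↭-length; shift)
import Data.List.Relation.Binary.Permutation.Setoid.Properties as ↭ₛ
open import Data.List.Relation.Unary.All as All using (All; []; _∷_)
open import Data.List.Relation.Unary.AllPairs using ([]; _∷_)
open import Data.List.Relation.Unary.Any using (here; there)
open import Data.List.Relation.Unary.Unique.Propositional using (Unique)
import Data.List.Relation.Unary.Unique.Propositional.Properties as Unique
import Data.List.Relation.Unary.All.Properties as All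
open import Data.Nat.Base
open import Data.Nat.Coprimality using (Coprime; coprime-divisor)
open import Data.Nat.GCD using (gcd; gcd[m,n]∣m; gcd[m,n]∣n; gcd-greatest)
open import Data.Nat.Divisibility
open import Data.Nat.DivMod using (_%_; _/_; m<n⇒m%n≡m; [m+kn]%n≡m%n; m≡m%n+[m/n]*n)
open import Data.Nat.Induction using (<-rec)
open import Data.Nat.Primality
open import Data.Nat.Primality.Factorisation using (factorise)
open import Data.Nat.ListAction using (product)
open import Data.Nat.ListAction.Properties using (∈⇒∣product; product-↭)
open import Data.Nat.Properties
open import Data.Product.Base using (∃-syntax; _×_; _,_; proj₁; proj₂)
open import Data.Sum.Base using (inj₁; inj₂; [_,_]′)
open import Function.Base using (_∘_; id; case_of_)
open import Function.Bundles using (mk⇔)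
open import Relation.Binary.PropositionalEquality
open import Relation.Nullary.Decidable
  using (Dec; yes; no; does; decidable-stable; _×-dec_; dec-true; dec-false; ¬?)
open import Relation.Nullary.Negation using (¬_; contradiction)
open import Level using (0ℓ)
open import Relation.Unary using (Pred; Decidable)

-- With `k` the absolute value of Pw_p and `g` the GCD, the identity for an odd exponent reads k g =
-- (p + 1) ∏ (q - 1), so `k` is odd exactly when `g` carries the full power of 2 on the right. The
-- obstacle is that `g` is accessible only through what it divides and what divides it. If q²
-- divides N, then `g` divides q, so an even `g` can only be 2. If N is squarefree, `g` divides r² -
-- 1 for every prime r dividing N, and also N - (-1)^t; for three or more odd primes these
-- conditions contradict each other modulo 4, while for N = p q they force `g` to divide p (q - p).
-- Hence p and q are 2-adically close, which is the origin of the two valuation conditions.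
-- Conversely, for each exceptional N enough divisors of all entries are exhibited to rule out an
-- even `k`. For the same reason no gcd is ever evaluated: two gcds are equal because they have the
-- same divisors `c`, and nearly all lemmas speak of an arbitrary common divisor `c`.

private
  variable
    A B : Set
    xs ys : List A

-- Finite sums and products

∑ ∏ : List A → (A → ℤ) → ℤ
∑ xs f = sumℤ (map f xs)
∏ xs f = prodℤ (map f xs)

map-cong-∈ : ∀ {f g : A → B} (xs : List A) → (∀ {x} → x ∈ xs → f x ≡ g x) → map f xs ≡ map g xs
map-cong-∈ []       f≗g = refl
map-cong-∈ (x ∷ xs) f≗g = cong₂ _∷_ (f≗g (here refl)) (map-cong-∈ xs (f≗g ∘ there))

∑-cong : ∀ {f g : A → ℤ} (xs : List A) → (∀ {x} → x ∈ xs → f x ≡ g x) → ∑ xs f ≡ ∑ xs g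
∑-cong xs f≗g = cong sumℤ (map-cong-∈ xs f≗g)

∏-cong : ∀ {f g : A → ℤ} (xs : List A) → (∀ {x} → x ∈ xs → f x ≡ g x) → ∏ xs f ≡ ∏ xs g
∏-cong xs f≗g = cong prodℤ (map-cong-∈ xs f≗g)

∑-↭ : ∀ (f : A → ℤ) → xs ↭ ys → ∑ xs f ≡ ∑ ys f
∑-↭ f xs↭ys = ↭ₛ.foldr-commMonoid (setoid ℤ) ℤ.+-0-isCommutativeMonoid (↭⇒↭ₛ (map⁺ f xs↭ys))

∏-↭ : ∀ (f : A → ℤ) → xs ↭ ys → ∏ xs f ≡ ∏ ys f
∏-↭ f xs↭ys = ↭ₛ.foldr-commMonoid (setoid ℤ) ℤ.*-1-isCommutativeMonoid (↭⇒↭ₛ (map⁺ f xs↭ys))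

∑-++ : ∀ (f : A → ℤ) xs ys → ∑ (xs ++ ys) f ≡ ∑ xs f ℤ.+ ∑ ys f
∑-++ f []       ys = sym (ℤ.+-identityˡ _)
∑-++ f (x ∷ xs) ys = begin
  f x ℤ.+ ∑ (xs ++ ys) f           ≡⟨ cong (λ z → f x ℤ.+ z) (∑-++ f xs ys) ⟩
  f x ℤ.+ (∑ xs f ℤ.+ ∑ ys f)      ≡⟨ ℤ.+-assoc (f x) _ _ ⟨
  f x ℤ.+ ∑ xs f ℤ.+ ∑ ys f        ∎
  where open ≡-Reasoning

∑-map : ∀ (f : B → ℤ) (g : A → B) xs → ∑ (map g xs) f ≡ ∑ xs (f ∘ g)
∑-map f g xs = cong sumℤ (sym (map-∘ xs))

∑-distribˡ-* : ∀ c (f : A → ℤ) xs → ∑ xs (λ x → c ℤ.* f x) ≡ c ℤ.* ∑ xs f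
∑-distribˡ-* c f []       = sym (ℤ.*-zeroʳ c)
∑-distribˡ-* c f (x ∷ xs) =
  trans (cong (λ z → c ℤ.* f x ℤ.+ z) (∑-distribˡ-* c f xs)) (sym (ℤ.*-distribˡ-+ c (f x) _))

∑-distrib-- : ∀ (f g : A → ℤ) xs → ∑ xs (λ x → f x ℤ.- g x) ≡ ∑ xs f ℤ.- ∑ xs g
∑-distrib-- f g []       = refl
∑-distrib-- f g (x ∷ xs) = trans (cong (λ z → f x ℤ.- g x ℤ.+ z) (∑-distrib-- f g xs)) (rearrange (f x) (g x) _ _)
  where
  rearrange : ∀ a b c d → a ℤ.- b ℤ.+ (c ℤ.- d) ≡ a ℤ.+ c ℤ.- (b ℤ.+ d)
  rearrange = ℤ-Ring.solve-∀

∑-zero : ∀ {f : A → ℤ} (xs : List A) → (∀ {x} → x ∈ xs → f x ≡ 0ℤ) → ∑ xs f ≡ 0ℤ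
∑-zero []       f≗0 = refl
∑-zero (x ∷ xs) f≗0 = cong₂ ℤ._+_ (f≗0 (here refl)) (∑-zero xs (f≗0 ∘ there))

∑-cartesianProduct : ∀ (f : A → ℤ) (g : B → ℤ) xs ys →
  ∑ (cartesianProduct xs ys) (λ (x , y) → f x ℤ.* g y) ≡ ∑ xs f ℤ.* ∑ ys g
∑-cartesianProduct f g []       ys = refl
∑-cartesianProduct f g (x ∷ xs) ys = begin
  ∑ (map (x ,_) ys ++ cartesianProduct xs ys) h
    ≡⟨ ∑-++ h (map (x ,_) ys) (cartesianProduct xs ys) ⟩
  ∑ (map (x ,_) ys) h ℤ.+ ∑ (cartesianProduct xs ys) h
    ≡⟨ cong₂ ℤ._+_ (trans (∑-map h (x ,_) ys) (∑-distribˡ-* (f x) g ys)) (∑-cartesianProduct f g xs ys) ⟩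
  f x ℤ.* ∑ ys g ℤ.+ ∑ xs f ℤ.* ∑ ys g
    ≡⟨ ℤ.*-distribʳ-+ (∑ ys g) (f x) (∑ xs f) ⟨
  ∑ (x ∷ xs) f ℤ.* ∑ ys g ∎
  where
  open ≡-Reasoning
  h = λ (z : _ × _) → f (proj₁ z) ℤ.* g (proj₂ z)

∑-filter : ∀ {P : Pred A 0ℓ} (P? : Decidable P) (f : A → ℤ) xs →
  ∑ (filter P? xs) f ≡ ∑ xs (λ x → (if does (P? x) then 1ℤ else 0ℤ) ℤ.* f x)
∑-filter P? f []       = refl
∑-filter P? f (x ∷ xs) with does (P? x)
... | true  = cong₂ ℤ._+_ (sym (ℤ.*-identityˡ (f x))) (∑-filter P? f xs)
... | false = trans (∑-filter P? f xs) (sym (ℤ.+-identityˡ _))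

δ-true : ∀ {m n} → m ≡ n → P m n ≡ 1ℤ
δ-true {m} {n} m≡n rewrite dec-true (m ≟ n) m≡n = refl

δ-false : ∀ {m n} → m ≢ n → P m n ≡ 0ℤ
δ-false {m} {n} m≢n rewrite dec-false (m ≟ n) m≢n = refl

∑-single : ∀ (f : ℕ → ℤ) {xs n} → Unique xs → n ∈ xs → ∑ xs (λ x → f x ℤ.* P n x) ≡ f n
∑-single f {x ∷ xs} {n} (x∉xs ∷ _) (here refl) = begin
  f n ℤ.* P n n ℤ.+ ∑ xs (λ x → f x ℤ.* P n x)
    ≡⟨ cong₂ (λ a b → f n ℤ.* a ℤ.+ b) (δ-true {n} refl)
         (∑-zero xs λ {x} x∈xs → trans (cong (λ z → f x ℤ.* z) (δ-false (All.lookup x∉xs x∈xs))) (ℤ.*-zeroʳ (f x))) ⟩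
  f n ℤ.* 1ℤ ℤ.+ 0ℤ ≡⟨ ℤ.+-identityʳ _ ⟩
  f n ℤ.* 1ℤ        ≡⟨ ℤ.*-identityʳ _ ⟩
  f n               ∎
  where open ≡-Reasoning
∑-single f {x ∷ xs} {n} (x∉xs ∷ uxs) (there n∈xs) = begin
  f x ℤ.* P n x ℤ.+ ∑ xs (λ x → f x ℤ.* P n x)
    ≡⟨ cong₂ (λ a b → f x ℤ.* a ℤ.+ b) (δ-false (≢-sym (All.lookup x∉xs n∈xs))) (∑-single f uxs n∈xs) ⟩
  f x ℤ.* 0ℤ ℤ.+ f n ≡⟨ cong (λ z → z ℤ.+ f n) (ℤ.*-zeroʳ (f x)) ⟩
  0ℤ ℤ.+ f n         ≡⟨ ℤ.+-identityˡ (f n) ⟩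
  f n                ∎
  where open ≡-Reasoning

-- Duplicate-free lists

-- Injectivity is asked on the list only: the map (e , d) ↦ d p^e to which this is applied is
-- injective only for d prime to p.
unique-map : ∀ {f : A → B} {xs} → (∀ {x y} → x ∈ xs → y ∈ xs → f x ≡ f y → x ≡ y) →
  Unique xs → Unique (map f xs)
unique-map f-inj []         = []
unique-map f-inj (x∉xs ∷ u) =
  All.map⁺ (All.tabulate λ y∈xs fx≡fy → All.lookup x∉xs y∈xs (f-inj (here refl) (there y∈xs) fx≡fy))
  ∷ unique-map (λ x∈ y∈ → f-inj (there x∈) (there y∈)) u

-- `divisors` lists by size, which does not respect the factorisation of N. Sums and products are
-- therefore compared up to permutation, and for duplicate-free lists that is equality of sets.
unique-↭ : Unique xs → Unique ys → (∀ {x} → x ∈ xs → x ∈ ys) → (∀ {x} → x ∈ ys → x ∈ xs) → xs ↭ ys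
unique-↭ uxs uys to from = ∼bag⇒↭ (unique∧set⇒bag uxs uys (mk⇔ to from))

-- Divisors and valuations

divisors-unique : ∀ n → Unique (divisors n)
divisors-unique n = Unique.filter⁺ (_∣? n) (Unique.upTo⁺ (suc n))

primeDivisors-unique : ∀ n → Unique (primeDivisors n)
primeDivisors-unique n = Unique.filter⁺ prime? (divisors-unique n)

∈-divisors⁺ : ∀ {n d} .{{_ : NonZero n}} → d ∣ n → d ∈ divisors n
∈-divisors⁺ {n} d∣n = ∈-filter⁺ (_∣? n) (∈-upTo⁺ (s≤s (∣⇒≤ d∣n))) d∣n

∈-divisors⁻ : ∀ n {d} → d ∈ divisors n → d ∣ n
∈-divisors⁻ n d∈ = proj₂ (∈-filter⁻ (_∣? n) {xs = upTo (suc n)} d∈)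

∈-primeDivisors⁺ : ∀ {n p} .{{_ : NonZero n}} → Prime p → p ∣ n → p ∈ primeDivisors n
∈-primeDivisors⁺ pr p∣n = ∈-filter⁺ prime? (∈-divisors⁺ p∣n) pr

∈-primeDivisors⁻ : ∀ n {p} → p ∈ primeDivisors n → Prime p × p ∣ n
∈-primeDivisors⁻ n p∈ with ∈-filter⁻ prime? {xs = divisors n} p∈
... | p∈′ , pr = pr , ∈-divisors⁻ n p∈′

prime>1 : ∀ {p} → Prime p → 1 < p
prime>1 {p} pr = nonTrivial⇒n>1 p {{prime⇒nonTrivial pr}}

prime∤1 : ∀ {p} → Prime p → p ∤ 1
prime∤1 pr p∣1 = contradiction (subst Prime (∣1⇒≡1 p∣1) pr) ¬prime[1]

pred≡-1 : ∀ n .{{_ : NonZero n}} → + pred n ≡ + n ℤ.- 1ℤ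
pred≡-1 (suc n) = refl

pred≢0 : ∀ {p} → Prime p → NonZero (pred p)
pred≢0 pr = >-nonZero (pred-mono-≤ (prime>1 pr))

prime∣prime⇒≡ : ∀ {p q} → Prime p → Prime q → p ∣ q → p ≡ q
prime∣prime⇒≡ pr qr p∣q with prime⇒irreducible qr p∣q
... | inj₁ refl = contradiction pr ¬prime[1]
... | inj₂ p≡q  = p≡q

prime∣^⇒∣ : ∀ {p} m k → Prime p → p ∣ m ^ k → p ∣ m
prime∣^⇒∣ m zero    pr p∣1 = contradiction p∣1 (prime∤1 pr)
prime∣^⇒∣ m (suc k) pr p∣  = [ id , prime∣^⇒∣ m k pr ]′ (euclidsLemma m (m ^ k) pr p∣)

^-monoʳ-∣ : ∀ p {j k} → j ≤ k → p ^ j ∣ p ^ k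
^-monoʳ-∣ p {j} {k} j≤k =
  divides (p ^ (k ∸ j)) (trans (cong (p ^_) (sym (m∸n+n≡m j≤k))) (^-distribˡ-+-* p (k ∸ j) j))

n<p^n : ∀ {p} → 1 < p → ∀ n → n < p ^ n
n<p^n           1<p zero    = z<s
n<p^n {p} 1<p (suc n) = ≤-<-trans (n<p^n 1<p n) (^-monoʳ-< p 1<p (n<1+n n))

-- The search descends from `b`, and every exponent above `k` fails because p^(k+1) would then
-- divide `n`.
largestExponent≡ : ∀ p n {k} → p ^ k ∣ n → p ^ suc k ∤ n → ∀ b → k ≤ b → largestExponent p n b ≡ k
largestExponent≡ p n         p^k∣n p^1+k∤n zero    z≤n = refl
largestExponent≡ p n {k} p^k∣n p^1+k∤n (suc b) k≤1+b with p ^ suc b ∣? n | m≤n⇒m<n∨m≡n k≤1+b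
... | yes p^1+b∣n | inj₁ k<1+b = contradiction (∣-trans (^-monoʳ-∣ p k<1+b) p^1+b∣n) p^1+k∤n
... | yes _       | inj₂ k≡1+b = sym k≡1+b
... | no _        | inj₁ k<1+b = largestExponent≡ p n p^k∣n p^1+k∤n b (s≤s⁻¹ k<1+b)
... | no p^1+b∤n  | inj₂ refl  = contradiction p^k∣n p^1+b∤n

val≡ : ∀ {p n k} .{{_ : NonZero n}} → 1 < p → p ^ k ∣ n → p ^ suc k ∤ n → val p n ≡ k
val≡ {p} {n} {k} 1<p p^k∣n p^1+k∤n =
  largestExponent≡ p n p^k∣n p^1+k∤n n (<⇒≤ (<-≤-trans (n<p^n 1<p k) (∣⇒≤ p^k∣n)))

val-*^ : ∀ {p m} k .{{_ : NonZero m}} → 1 < p → p ∤ m → val p (m * p ^ k) ≡ k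
val-*^ {p} {m} k 1<p p∤m = val≡ {{m*n≢0 m (p ^ k)}} 1<p (n∣m*n m)
    (λ h → p∤m (*-cancelʳ-∣ (p ^ k) h))
  where instance
    _ = >-nonZero (<⇒≤ 1<p)
    _ = m^n≢0 p k

split : ∀ {p} → 1 < p → ∀ n .{{_ : NonZero n}} → ∃[ m ] ∃[ k ] n ≡ m * p ^ k × p ∤ m
split {p} 1<p n = <-rec Q step n
  where
  instance _ = n>1⇒nonTrivial 1<p
  Q : ℕ → Set
  Q n = .{{_ : NonZero n}} → ∃[ m ] ∃[ k ] n ≡ m * p ^ k × p ∤ m
  step : ∀ n → (∀ {m} → m < n → Q m) → Q n
  step n rec with p ∣? n
  ... | no p∤n  = n , 0 , sym (*-identityʳ n) , p∤n
  ... | yes p∣n with rec (quotient-< p∣n) {{quotient≢0 p∣n}}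
  ...   | m , k , q≡ , p∤m = m , suc k , n≡ , p∤m
    where
    open ≡-Reasoning
    n≡ : n ≡ m * p ^ suc k
    n≡ = begin
      n                ≡⟨ m∣n⇒n≡m*quotient p∣n ⟩
      p * quotient p∣n ≡⟨ cong (p *_) q≡ ⟩
      p * (m * p ^ k)  ≡⟨ *-assoc p m (p ^ k) ⟨
      p * m * p ^ k    ≡⟨ cong (_* p ^ k) (*-comm p m) ⟩
      m * p * p ^ k    ≡⟨ *-assoc m p (p ^ k) ⟩
      m * p ^ suc k    ∎

val-1 : ∀ {p} → Prime p → val p 1 ≡ 0
val-1 {p} pr = val≡ (prime>1 pr) ∣-refl λ p^1∣1 → prime∤1 pr (subst (_∣ 1) (^-identityʳ p) p^1∣1)

val-*^-other : ∀ {p q} m k .{{_ : NonZero m}} → Prime p → Prime q → q ≢ p → val q (m * p ^ k) ≡ val q m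
val-*^-other {p} {q} m k pr qr q≢p with split (prime>1 qr) m
... | m′ , j , refl , q∤m′ = begin
  val q (m′ * q ^ j * p ^ k)   ≡⟨ cong (val q) (*-assoc m′ (q ^ j) (p ^ k)) ⟩
  val q (m′ * (q ^ j * p ^ k)) ≡⟨ cong (λ x → val q (m′ * x)) (*-comm (q ^ j) (p ^ k)) ⟩
  val q (m′ * (p ^ k * q ^ j)) ≡⟨ cong (val q) (*-assoc m′ (p ^ k) (q ^ j)) ⟨
  val q (m′ * p ^ k * q ^ j)   ≡⟨ val-*^ j (prime>1 qr) q∤m′p^k ⟩
  j                            ≡⟨ val-*^ j (prime>1 qr) q∤m′ ⟨
  val q (m′ * q ^ j)           ∎
  where
  open ≡-Reasoning
  instance
    _ = prime⇒nonZero pr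
    _ = prime⇒nonZero qr
    _ = m^n≢0 p k
    m′≢0 : NonZero m′
    m′≢0 = m*n≢0⇒m≢0 m′
    _ = m*n≢0 m′ (p ^ k)
  q∤m′p^k : q ∤ m′ * p ^ k
  q∤m′p^k h = [ q∤m′ , q≢p ∘ prime∣prime⇒≡ qr pr ∘ prime∣^⇒∣ p k qr ]′ (euclidsLemma m′ (p ^ k) qr h)

∃-primeDivisor : ∀ n → 1 < n → ∃[ p ] Prime p × p ∣ n
∃-primeDivisor n@(suc _) 1<n with factorise n
... | record { factors = [] ; isFactorisation = refl } = contradiction 1<n λ { (s≤s ()) }
... | record { factors = p ∷ ps ; isFactorisation = n≡ ; factorsPrime = pr ∷ _ } =
  p , pr , divides (product ps) (trans n≡ (*-comm p (product ps)))

-- Each step strips the whole p-part of N, not a single factor p, so that p does not divide the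
-- remaining `M` and the local factor at p splits off.
factorisation-induction : (Q : ℕ → Set) → Q 1 →
  (∀ M p r .{{_ : NonZero M}} → Prime p → p ∤ M → Q M → Q (M * p ^ suc r)) →
  ∀ n .{{_ : NonZero n}} → Q n
factorisation-induction Q base extend n = <-rec Q′ step n
  where
  Q′ : ℕ → Set
  Q′ n = .{{_ : NonZero n}} → Q n
  step : ∀ n → (∀ {m} → m < n → Q′ m) → Q′ n
  step 1          rec = base
  step n@(2+ _) rec with ∃-primeDivisor n (s≤s (s≤s z≤n))
  ... | p , pr , p∣n with split (prime>1 pr) n
  ...   | M , zero  , n≡ , p∤M = contradiction (subst (p ∣_) (trans n≡ (*-identityʳ M)) p∣n) p∤M
  ...   | M , suc k , n≡ , p∤M = subst Q (sym n≡) (extend M p k pr p∤M (rec M<n))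
    where
    instance
      M≢0 : NonZero M
      M≢0 = m*n≢0⇒m≢0 M {{subst NonZero n≡ _}}
    M<n : M < n
    M<n = subst (M <_) (sym n≡) (m<m*n M (p ^ suc k) (≤-<-trans (s≤s z≤n) (n<p^n (prime>1 pr) (suc k))))

coprime⇒∣-cancel-^ : ∀ {p d m} k → Prime p → p ∤ d → d ∣ m * p ^ k → d ∣ m
coprime⇒∣-cancel-^ {p} {d} {m} zero    pr p∤d d∣ = subst (d ∣_) (*-identityʳ m) d∣
coprime⇒∣-cancel-^ {p} {d} {m} (suc k) pr p∤d d∣ =
  coprime⇒∣-cancel-^ k pr p∤d (coprime-divisor coprime (subst (d ∣_) m*p^1+k≡ d∣))
  where
  coprime : Coprime d p
  coprime {i} (i∣d , i∣p) = [ id , (λ i≡p → contradiction (subst (_∣ d) i≡p i∣d) p∤d) ]′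
                              (prime⇒irreducible pr i∣p)
  m*p^1+k≡ : m * p ^ suc k ≡ p * (m * p ^ k)
  m*p^1+k≡ = trans (*-comm m (p ^ suc k)) (trans (*-assoc p (p ^ k) m) (cong (p *_) (*-comm (p ^ k) m)))

divisor-*^ : ∀ {p M d} k .{{_ : NonZero M}} → Prime p → p ∤ M → d ∣ M * p ^ k →
  ∃[ e ] ∃[ d′ ] e ≤ k × d′ ∣ M × d ≡ d′ * p ^ e
divisor-*^ {p} {M} {d} k pr p∤M d∣ = helper
  where
  instance
    _ = prime⇒nonZero pr
    _ = m^n≢0 p k
    N≢0 : NonZero (M * p ^ k)
    N≢0 = m*n≢0 M (p ^ k)
    d≢0 : NonZero d
    d≢0 = ≢-nonZero λ d≡0 → ≢-nonZero⁻¹ (M * p ^ k) (0∣⇒≡0 (subst (_∣ M * p ^ k) d≡0 d∣))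
  helper : ∃[ e ] ∃[ d′ ] e ≤ k × d′ ∣ M × d ≡ d′ * p ^ e
  helper with split (prime>1 pr) d
  ... | d′ , e , d≡ , p∤d′ = e , d′ , e≤k , d′∣M , d≡
    where
    d′∣M : d′ ∣ M
    d′∣M = coprime⇒∣-cancel-^ k pr p∤d′ (∣-trans (subst (d′ ∣_) (sym d≡) (m∣m*n (p ^ e))) d∣)
    p^e∣ : p ^ e ∣ M * p ^ k
    p^e∣ = ∣-trans (subst (p ^ e ∣_) (sym d≡) (n∣m*n d′)) d∣
    e≤k : e ≤ k
    e≤k = ≮⇒≥ λ k<e → p∤M (*-cancelʳ-∣ (p ^ k) (∣-trans (^-monoʳ-∣ p k<e) p^e∣))

∣⇒nonZero : ∀ {d n} .{{_ : NonZero n}} → d ∣ n → NonZero d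
∣⇒nonZero {d} {n} d∣n = ≢-nonZero λ d≡0 → ≢-nonZero⁻¹ n (0∣⇒≡0 (subst (_∣ n) d≡0 d∣n))

primeDivisors-*^ : ∀ {p M} r .{{_ : NonZero M}} → Prime p → p ∤ M →
  primeDivisors (M * p ^ suc r) ↭ p ∷ primeDivisors M
primeDivisors-*^ {p} {M} r pr p∤M =
  unique-↭ (primeDivisors-unique (M * p ^ suc r)) (p∉ ∷ primeDivisors-unique M) to from
  where
  instance
    _ = prime⇒nonZero pr
    _ = m^n≢0 p (suc r)
    N≢0 : NonZero (M * p ^ suc r)
    N≢0 = m*n≢0 M (p ^ suc r)
  p∉ : All (p ≢_) (primeDivisors M)
  p∉ = All.tabulate λ { q∈ refl → p∤M (proj₂ (∈-primeDivisors⁻ M q∈)) }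
  to : ∀ {q} → q ∈ primeDivisors (M * p ^ suc r) → q ∈ p ∷ primeDivisors M
  to q∈ with ∈-primeDivisors⁻ (M * p ^ suc r) q∈
  ... | qr , q∣ with euclidsLemma M (p ^ suc r) qr q∣
  ...   | inj₁ q∣M = there (∈-primeDivisors⁺ qr q∣M)
  ...   | inj₂ q∣p^ = here (prime∣prime⇒≡ qr pr (prime∣^⇒∣ p (suc r) qr q∣p^))
  from : ∀ {q} → q ∈ p ∷ primeDivisors M → q ∈ primeDivisors (M * p ^ suc r)
  from (here refl) = ∈-primeDivisors⁺ pr (∣n⇒∣m*n M (m∣m*n (p ^ r)))
  from (there q∈)  with ∈-primeDivisors⁻ M q∈
  ... | qr , q∣M = ∈-primeDivisors⁺ qr (∣m⇒∣m*n (p ^ suc r) q∣M)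

-- The exponent `e` is recovered from d p^e as its p-adic valuation, because p does not divide `d`.
divisors-*^ : ∀ {p M} k .{{_ : NonZero M}} → Prime p → p ∤ M →
  divisors (M * p ^ k) ↭ map (λ (e , d) → d * p ^ e) (cartesianProduct (upTo (suc k)) (divisors M))
divisors-*^ {p} {M} k pr p∤M =
  unique-↭ (divisors-unique (M * p ^ k))
    (unique-map injective (Unique.cartesianProduct⁺ (Unique.upTo⁺ (suc k)) (divisors-unique M))) to from
  where
  instance
    _ = prime⇒nonZero pr
    _ = m^n≢0 p k
    N≢0 : NonZero (M * p ^ k)
    N≢0 = m*n≢0 M (p ^ k)
  f : ℕ × ℕ → ℕ
  f (e , d) = d * p ^ e
  pairs : List (ℕ × ℕ)
  pairs = cartesianProduct (upTo (suc k)) (divisors M)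
  pairs⁻ : ∀ {e d} → (e , d) ∈ pairs → e ≤ k × d ∣ M
  pairs⁻ z∈ with ∈-cartesianProduct⁻ (upTo (suc k)) (divisors M) z∈
  ... | e∈ , d∈ = s≤s⁻¹ (∈-upTo⁻ e∈) , ∈-divisors⁻ M d∈
  val-f : ∀ {e d} → (e , d) ∈ pairs → val p (d * p ^ e) ≡ e
  val-f {e} z∈ with pairs⁻ z∈
  ... | _ , d∣M = val-*^ e {{∣⇒nonZero d∣M}} (prime>1 pr) (λ p∣d → p∤M (∣-trans p∣d d∣M))
  injective : ∀ {x y} → x ∈ pairs → y ∈ pairs → f x ≡ f y → x ≡ y
  injective {e , d} {e′ , d′} x∈ y∈ eq = cong₂ _,_ e≡e′
    (*-cancelʳ-≡ d d′ (p ^ e) {{m^n≢0 p e}} (trans eq (cong (λ e → d′ * p ^ e) (sym e≡e′))))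
    where
    e≡e′ : e ≡ e′
    e≡e′ = trans (sym (val-f x∈)) (trans (cong (val p) eq) (val-f y∈))
  to : ∀ {n} → n ∈ divisors (M * p ^ k) → n ∈ map f pairs
  to n∈ with divisor-*^ k pr p∤M (∈-divisors⁻ (M * p ^ k) n∈)
  ... | e , d , e≤k , d∣M , refl = ∈-map⁺ f (∈-cartesianProduct⁺ (∈-upTo⁺ (s≤s e≤k)) (∈-divisors⁺ d∣M))
  from : ∀ {n} → n ∈ map f pairs → n ∈ divisors (M * p ^ k)
  from n∈ with ∈-map⁻ f n∈
  ... | (e , d) , z∈ , refl with pairs⁻ z∈
  ...   | e≤k , d∣M = ∈-divisors⁺ (*-pres-∣ d∣M (^-monoʳ-∣ p e≤k))

∑-divisors-*^ : ∀ {p M} k .{{_ : NonZero M}} → Prime p → p ∤ M → (F f g : ℕ → ℤ) →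
  (∀ {e d} → e ≤ k → d ∣ M → F (d * p ^ e) ≡ g e ℤ.* f d) →
  ∑ (divisors (M * p ^ k)) F ≡ ∑ (upTo (suc k)) g ℤ.* ∑ (divisors M) f
∑-divisors-*^ {p} {M} k pr p∤M F f g F-splits = begin
  ∑ (divisors (M * p ^ k)) F
    ≡⟨ ∑-↭ F (divisors-*^ k pr p∤M) ⟩
  ∑ (map (λ (e , d) → d * p ^ e) pairs) F
    ≡⟨ ∑-map F (λ (e , d) → d * p ^ e) pairs ⟩
  ∑ pairs (λ (e , d) → F (d * p ^ e))
    ≡⟨ ∑-cong pairs (λ z∈ → let e∈ , d∈ = ∈-cartesianProduct⁻ (upTo (suc k)) (divisors M) z∈
                             in F-splits (s≤s⁻¹ (∈-upTo⁻ e∈)) (∈-divisors⁻ M d∈)) ⟩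
  ∑ pairs (λ (e , d) → g e ℤ.* f d)
    ≡⟨ ∑-cartesianProduct g f (upTo (suc k)) (divisors M) ⟩
  ∑ (upTo (suc k)) g ℤ.* ∑ (divisors M) f ∎
  where
  open ≡-Reasoning
  pairs = cartesianProduct (upTo (suc k)) (divisors M)

-- Multiplicative functions of N and δ

-- An Euler product whose factor at p sees only the exponents of p in N and δ. If the factor ignores
-- its last argument, `mult h N N` is a multiplicative function of N alone; thus `mult-*^` serves
-- both kinds.
mult : (ℕ → ℕ → ℕ → ℤ) → ℕ → ℕ → ℤ
mult h N δ = ∏ (primeDivisors N) (λ p → h p (val p N) (val p δ))

mult-*^ : ∀ h {p M d} r e .{{_ : NonZero M}} → Prime p → p ∤ M → d ∣ M →
  mult h (M * p ^ suc r) (d * p ^ e) ≡ h p (suc r) e ℤ.* mult h M d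
mult-*^ h {p} {M} {d} r e pr p∤M d∣M = begin
  ∏ (primeDivisors (M * p ^ suc r)) H
    ≡⟨ ∏-↭ H (primeDivisors-*^ r pr p∤M) ⟩
  H p ℤ.* ∏ (primeDivisors M) H
    ≡⟨ cong₂ ℤ._*_
         (cong₂ (h p) (val-*^ (suc r) (prime>1 pr) p∤M) (val-*^ e (prime>1 pr) p∤d))
         (∏-cong (primeDivisors M) λ {q} q∈ →
            let qr , q∣M = ∈-primeDivisors⁻ M q∈
                q≢p = λ q≡p → p∤M (subst (_∣ M) q≡p q∣M)
            in cong₂ (h q) (val-*^-other M (suc r) pr qr q≢p) (val-*^-other d e pr qr q≢p)) ⟩
  h p (suc r) e ℤ.* mult h M d ∎
  where
  open ≡-Reasoning
  instance
    d≢0 : NonZero d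
    d≢0 = ∣⇒nonZero d∣M
  p∤d : p ∤ d
  p∤d p∣d = p∤M (∣-trans p∣d d∣M)
  H : ℕ → ℤ
  H q = h q (val q (M * p ^ suc r)) (val q (d * p ^ e))

-- The sum over the divisors factors into local sums over the exponents; both sides obey the same
-- recursion `mult-*^` when a prime power is split off.
∑-mult : ∀ h N .{{_ : NonZero N}} →
  ∑ (divisors N) (mult h N) ≡ mult (λ p r _ → ∑ (upTo (suc r)) (h p r)) N N
∑-mult h N = factorisation-induction
  (λ N → ∑ (divisors N) (mult h N) ≡ mult H N N) refl extend N
  where
  H : ℕ → ℕ → ℕ → ℤ
  H p r _ = ∑ (upTo (suc r)) (h p r)
  extend : ∀ M p r .{{_ : NonZero M}} → Prime p → p ∤ M →
    ∑ (divisors M) (mult h M) ≡ mult H M M →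
    ∑ (divisors (M * p ^ suc r)) (mult h (M * p ^ suc r)) ≡ mult H (M * p ^ suc r) (M * p ^ suc r)
  extend M p r pr p∤M ih =
    trans (∑-divisors-*^ (suc r) pr p∤M (mult h (M * p ^ suc r)) (mult h M) (h p (suc r))
            (λ {e} _ d∣M → mult-*^ h r e pr p∤M d∣M))
    (trans (cong (λ z → H p (suc r) 0 ℤ.* z) ih)
      (sym (mult-*^ H r (suc r) pr p∤M ∣-refl)))

mult-^ : ∀ N .{{_ : NonZero N}} → mult (λ p r _ → + (p ^ r)) N N ≡ + N
mult-^ = factorisation-induction (λ N → mult h N N ≡ + N) refl extend
  where
  h : ℕ → ℕ → ℕ → ℤ
  h p r _ = + (p ^ r)
  extend : ∀ M p r .{{_ : NonZero M}} → Prime p → p ∤ M → mult h M M ≡ + M →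
    mult h (M * p ^ suc r) (M * p ^ suc r) ≡ + (M * p ^ suc r)
  extend M p r pr p∤M ih = begin
    mult h (M * p ^ suc r) (M * p ^ suc r) ≡⟨ mult-*^ h r (suc r) pr p∤M ∣-refl ⟩
    + (p ^ suc r) ℤ.* mult h M M           ≡⟨ cong (λ z → + (p ^ suc r) ℤ.* z) ih ⟩
    + (p ^ suc r) ℤ.* + M                  ≡⟨ ℤ.pos-* (p ^ suc r) M ⟨
    + (p ^ suc r * M)                      ≡⟨ cong +_ (*-comm (p ^ suc r) M) ⟩
    + (M * p ^ suc r)                      ∎
    where open ≡-Reasoning

∃-divisor : ∀ (e : ℕ → ℕ) N .{{_ : NonZero N}} →
  (∀ {p} → p ∈ primeDivisors N → e p ≤ val p N) →
  ∃[ δ ] δ ∣ N × (∀ {p} → p ∈ primeDivisors N → val p δ ≡ e p)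
∃-divisor e = factorisation-induction
  (λ N → (∀ {p} → p ∈ primeDivisors N → e p ≤ val p N) →
    ∃[ δ ] δ ∣ N × (∀ {p} → p ∈ primeDivisors N → val p δ ≡ e p))
  (λ _ → 1 , ∣-refl , λ ()) extend
  where
  Admissible Realised : ℕ → Set
  Admissible N = ∀ {p} → p ∈ primeDivisors N → e p ≤ val p N
  Realised N = ∃[ δ ] δ ∣ N × (∀ {p} → p ∈ primeDivisors N → val p δ ≡ e p)
  extend : ∀ M p r .{{_ : NonZero M}} → Prime p → p ∤ M → (Admissible M → Realised M) →
    Admissible (M * p ^ suc r) → Realised (M * p ^ suc r)
  extend M p r pr p∤M ih e≤ = realised
    where
    PD↭ = primeDivisors-*^ r pr p∤M
    ≢p : ∀ {q} → q ∈ primeDivisors M → q ≢ p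
    ≢p q∈ refl = p∤M (proj₂ (∈-primeDivisors⁻ M q∈))
    e≤M : Admissible M
    e≤M {q} q∈ = subst (e q ≤_)
      (val-*^-other M (suc r) pr (proj₁ (∈-primeDivisors⁻ M q∈)) (≢p q∈))
      (e≤ (∈-resp-↭ (↭-sym PD↭) (there q∈)))
    ep≤ : e p ≤ suc r
    ep≤ = subst (e p ≤_) (val-*^ (suc r) (prime>1 pr) p∤M) (e≤ (∈-resp-↭ (↭-sym PD↭) (here refl)))
    realised : Realised (M * p ^ suc r)
    realised with ih e≤M
    ... | d , d∣M , val≡e = d * p ^ e p , *-pres-∣ d∣M (^-monoʳ-∣ p ep≤) , λ q∈ → eq (∈-resp-↭ PD↭ q∈)
      where
      instance
        d≢0 : NonZero d
        d≢0 = ∣⇒nonZero d∣M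
      eq : ∀ {q} → q ∈ p ∷ primeDivisors M → val q (d * p ^ e p) ≡ e q
      eq (here refl) = val-*^ (e p) (prime>1 pr) (λ p∣d → p∤M (∣-trans p∣d d∣M))
      eq (there q∈)  = trans (val-*^-other d (e p) pr (proj₁ (∈-primeDivisors⁻ M q∈)) (≢p q∈)) (val≡e q∈)

-- The entries of V(C_N)

-- Only the columns of Υ at the cusps of level 1 and N enter V(C_N) = U - W.
Υˡ Υʳ : ℕ → ℕ → ℕ → ℤ
Υˡ p r i = Υ-primePower p r i 0
Υʳ p r i = Υ-primePower p r i r

Υʳ-r : ∀ p r → Υʳ p r r ≡ + p
Υʳ-r p r rewrite dec-true (r ≟ r) refl | ∨-zeroʳ (does (r ≟ 0)) = refl

-- In the last column m(j) = 0, so the off-diagonal entry is -p^0.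
Υʳ-pred : ∀ p r → Υʳ p (suc r) r ≡ -1ℤ
Υʳ-pred p r
  rewrite dec-false (r ≟ suc r) (λ ())
        | trans (m≤n⇒∣m-n∣≡n∸m (n≤1+n r)) (m+n∸n≡m 1 r)
        | n∸n≡0 r = refl

Υʳ-< : ∀ p r {i} → suc i < r → Υʳ p r i ≡ 0ℤ
Υʳ-< p r {i} 1+i<r = zero-entry (<⇒≢ i<r) λ ∣i-r∣≡1 → <⇒≢ 1+i<r (begin
  suc i             ≡⟨ cong (_+ i) ∣i-r∣≡1 ⟨
  ∣ i - r ∣ + i     ≡⟨ cong (_+ i) (m≤n⇒∣m-n∣≡n∸m (<⇒≤ i<r)) ⟩
  r ∸ i + i         ≡⟨ m∸n+n≡m (<⇒≤ i<r) ⟩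
  r                 ∎)
  where
  open ≡-Reasoning
  i<r : i < r
  i<r = <-trans (n<1+n i) 1+i<r
  zero-entry : i ≢ r → ∣ i - r ∣ ≢ 1 → Υʳ p r i ≡ 0ℤ
  zero-entry i≢r ∣i-r∣≢1 rewrite dec-false (i ≟ r) i≢r | dec-false (∣ i - r ∣ ≟ 1) ∣i-r∣≢1 = refl

U W D : ℕ → ℕ → ℤ
U = mult Υˡ
W = mult Υʳ
D N δ = U N δ ℤ.- W N δ

V≡D : ∀ N δ → 1 < N → V N C⟨ N ⟩ δ ≡ D N δ
V≡D N δ 1<N = begin
  ∑ (divisors N) (λ d → Υ N δ d ℤ.* (P 1 d ℤ.- P N d))
    ≡⟨ ∑-cong (divisors N) (λ {d} _ → distrib (Υ N δ d) (P 1 d) (P N d)) ⟩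
  ∑ (divisors N) (λ d → Υ N δ d ℤ.* P 1 d ℤ.- Υ N δ d ℤ.* P N d)
    ≡⟨ ∑-distrib-- (λ d → Υ N δ d ℤ.* P 1 d) (λ d → Υ N δ d ℤ.* P N d) (divisors N) ⟩
  ∑ (divisors N) (λ d → Υ N δ d ℤ.* P 1 d) ℤ.- ∑ (divisors N) (λ d → Υ N δ d ℤ.* P N d)
    ≡⟨ cong₂ ℤ._-_ (∑-single (Υ N δ) (divisors-unique N) (∈-divisors⁺ (1∣ N)))
                   (∑-single (Υ N δ) (divisors-unique N) (∈-divisors⁺ ∣-refl)) ⟩
  Υ N δ 1 ℤ.- Υ N δ N
    ≡⟨ cong (λ z → z ℤ.- W N δ) (∏-cong (primeDivisors N) λ {p} p∈ →
         cong (Υ-primePower p (val p N) (val p δ)) (val-1 (proj₁ (∈-primeDivisors⁻ N p∈)))) ⟩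
  D N δ ∎
  where
  open ≡-Reasoning
  instance
    _ = >-nonZero (<⇒≤ 1<N)
  distrib : ∀ x y z → x ℤ.* (y ℤ.- z) ≡ x ℤ.* y ℤ.- x ℤ.* z
  distrib = ℤ-Ring.solve-∀

-- The greatest common divisor of V(C_N)

∣gcdℤ⁻ : ∀ {c xs} → c ∣ gcdℤ xs → ∀ {x} → x ∈ xs → c ∣ ℤ.∣ x ∣
∣gcdℤ⁻ {c} {x ∷ xs} c∣ (here refl) = ∣-trans c∣ (gcd[m,n]∣m ℤ.∣ x ∣ (gcdℤ xs))
∣gcdℤ⁻ {c} {x ∷ xs} c∣ (there y∈)  = ∣gcdℤ⁻ (∣-trans c∣ (gcd[m,n]∣n ℤ.∣ x ∣ (gcdℤ xs))) y∈

∣gcdℤ⁺ : ∀ {c} xs → (∀ {x} → x ∈ xs → c ∣ ℤ.∣ x ∣) → c ∣ gcdℤ xs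
∣gcdℤ⁺ {c} []       c∣ = c ∣0
∣gcdℤ⁺ {c} (x ∷ xs) c∣ = gcd-greatest (c∣ (here refl)) (∣gcdℤ⁺ xs (c∣ ∘ there))

∣gcdℤ-map⁻ : ∀ {c} {f : ℕ → ℤ} {xs} → c ∣ gcdℤ (map f xs) → ∀ {x} → x ∈ xs → + c ℤ.∣ f x
∣gcdℤ-map⁻ {f = f} c∣ x∈ = ℤ.∣ᵤ⇒∣ (∣gcdℤ⁻ c∣ (∈-map⁺ f x∈))

∣gcdℤ-map⁺ : ∀ {c} {f : ℕ → ℤ} xs → (∀ {x} → x ∈ xs → + c ℤ.∣ f x) → c ∣ gcdℤ (map f xs)
∣gcdℤ-map⁺ {c} {f} xs c∣ = ∣gcdℤ⁺ (map f xs) λ y∈ →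
  case ∈-map⁻ f y∈ of λ { (x , x∈ , refl) → ℤ.∣⇒∣ᵤ (c∣ x∈) }

-- Divisibility of the GCD by `c`, spelled out entrywise and in terms of `D`, so that it can be
-- tested on single rows.
CommonDivisor : ℕ → ℕ → Set
CommonDivisor c N = ∀ {δ} → δ ∣ N → + c ℤ.∣ D N δ

∣GCD⁻ : ∀ {c N} → 1 < N → c ∣ GCD N C⟨ N ⟩ → CommonDivisor c N
∣GCD⁻ {c} {N} 1<N c∣ {δ} δ∣N =
  subst (+ c ℤ.∣_) (V≡D N δ 1<N) (∣gcdℤ-map⁻ c∣ (∈-divisors⁺ {{>-nonZero (<⇒≤ 1<N)}} δ∣N))

∣GCD⁺ : ∀ {c N} → 1 < N → CommonDivisor c N → c ∣ GCD N C⟨ N ⟩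
∣GCD⁺ {c} {N} 1<N c∣ = ∣gcdℤ-map⁺ (divisors N) λ {δ} δ∈ →
  subst (+ c ℤ.∣_) (sym (V≡D N δ 1<N)) (c∣ (∈-divisors⁻ N δ∈))

-- As an indexed family, so that matching replaces N by M p^(r+1) throughout the goal.
data PrimePart (p : ℕ) : ℕ → Set where
  part : ∀ M r .{{_ : NonZero M}} → p ∤ M → PrimePart p (M * p ^ suc r)

primePart : ∀ {p n} .{{_ : NonZero n}} → Prime p → p ∣ n → PrimePart p n
primePart {p} {n} pr p∣n with split (prime>1 pr) n
... | M , zero  , n≡   , p∤M = contradiction (subst (p ∣_) (trans n≡ (*-identityʳ M)) p∣n) p∤M
... | M , suc r , refl , p∤M = part M r {{m*n≢0⇒m≢0 M}} p∤M

^∣⇒≤exponent : ∀ {p M j} k → Prime p → p ∤ M → p ^ j ∣ M * p ^ k → j ≤ k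
^∣⇒≤exponent {p} k pr p∤M p^j∣ =
  ≮⇒≥ λ k<j → p∤M (*-cancelʳ-∣ (p ^ k) {{m^n≢0 p k {{prime⇒nonZero pr}}}} (∣-trans (^-monoʳ-∣ p k<j) p^j∣))

∏-const : ∀ c (xs : List A) → ∏ xs (λ _ → c) ≡ c ℤ.^ length xs
∏-const c []       = refl
∏-const c (x ∷ xs) = cong (λ z → c ℤ.* z) (∏-const c xs)

∏-* : ∀ (f g : A → ℤ) xs → ∏ xs (λ x → f x ℤ.* g x) ≡ ∏ xs f ℤ.* ∏ xs g
∏-* f g []       = refl
∏-* f g (x ∷ xs) = trans (cong (λ z → f x ℤ.* g x ℤ.* z) (∏-* f g xs)) (rearrange (f x) (g x) _ _)
  where
  rearrange : ∀ a b c d → a ℤ.* b ℤ.* (c ℤ.* d) ≡ a ℤ.* c ℤ.* (b ℤ.* d)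
  rearrange = ℤ-Ring.solve-∀

-- The factors are exchanged one at a time: a c - b d = (a - b) c + b (c - d).
∏-cong-mod : ∀ {c} {f g : A → ℤ} (xs : List A) → (∀ {x} → x ∈ xs → c ℤ.∣ f x ℤ.- g x) →
  c ℤ.∣ ∏ xs f ℤ.- ∏ xs g
∏-cong-mod []       f≡g = ℤ.divides 0ℤ refl
∏-cong-mod {c = c} {f} {g} (x ∷ xs) f≡g =
  subst (c ℤ.∣_) (sym (rearrange (f x) (g x) (∏ xs f) (∏ xs g)))
    (ℤ.∣m∣n⇒∣m+n (ℤ.∣m⇒∣m*n (∏ xs f) (f≡g (here refl)))
                 (ℤ.∣n⇒∣m*n (g x) (∏-cong-mod xs (f≡g ∘ there))))
  where
  rearrange : ∀ a b c d → a ℤ.* c ℤ.- b ℤ.* d ≡ (a ℤ.- b) ℤ.* c ℤ.+ b ℤ.* (c ℤ.- d)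
  rearrange = ℤ-Ring.solve-∀

∣-1^n∣≡1 : ∀ n → ℤ.∣ -1ℤ ℤ.^ n ∣ ≡ 1
∣-1^n∣≡1 zero    = refl
∣-1^n∣≡1 (suc n) = trans (ℤ.abs-* -1ℤ (-1ℤ ℤ.^ n)) (trans (*-identityˡ _) (∣-1^n∣≡1 n))

∣-cancel-unit : ∀ {c} x u → ℤ.∣ u ∣ ≡ 1 → c ℤ.∣ x ℤ.* u → c ℤ.∣ x
∣-cancel-unit {c} x u ∣u∣≡1 c∣xu = ℤ.∣ᵤ⇒∣ (subst (ℤ.∣ c ∣ ∣_)
  (trans (ℤ.abs-* x u) (trans (cong (ℤ.∣ x ∣ *_) ∣u∣≡1) (*-identityʳ _))) (ℤ.∣⇒∣ᵤ c∣xu))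

D-*^ : ∀ {p M d} r e .{{_ : NonZero M}} → Prime p → p ∤ M → d ∣ M →
  D (M * p ^ suc r) (d * p ^ e) ≡ Υˡ p (suc r) e ℤ.* U M d ℤ.- Υʳ p (suc r) e ℤ.* W M d
D-*^ r e pr p∤M d∣M = cong₂ ℤ._-_ (mult-*^ Υˡ r e pr p∤M d∣M) (mult-*^ Υʳ r e pr p∤M d∣M)

∣⇒1≤val : ∀ {p N} .{{_ : NonZero N}} → Prime p → p ∣ N → 1 ≤ val p N
∣⇒1≤val {p} pr p∣N with primePart pr p∣N
... | part M r p∤M = subst (1 ≤_) (sym (val-*^ (suc r) (prime>1 pr) p∤M)) (s≤s z≤n)

-- The witness is the radical of `M`: at exponent 1 every left local factor is -1, whatever the
-- exponent in `M`.
∃-unitEntry : ∀ M .{{_ : NonZero M}} → ∃[ d ] d ∣ M × ℤ.∣ U M d ∣ ≡ 1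
∃-unitEntry M with ∃-divisor (λ _ → 1) M
  (λ p∈ → let pr , p∣M = ∈-primeDivisors⁻ M p∈ in ∣⇒1≤val pr p∣M)
... | d , d∣M , val≡1 = d , d∣M , (begin
  ℤ.∣ U M d ∣
    ≡⟨ cong ℤ.∣_∣ (∏-cong (primeDivisors M) λ {p} p∈ → cong (Υˡ p (val p M)) (val≡1 p∈)) ⟩
  ℤ.∣ ∏ (primeDivisors M) (λ _ → -1ℤ) ∣
    ≡⟨ cong ℤ.∣_∣ (∏-const -1ℤ (primeDivisors M)) ⟩
  ℤ.∣ -1ℤ ℤ.^ length (primeDivisors M) ∣
    ≡⟨ ∣-1^n∣≡1 (length (primeDivisors M)) ⟩
  1 ∎)
  where open ≡-Reasoning

-- The right column is supported on the last two exponents. When the exponent of p is at least 2,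
-- row 0 misses it, so the entry of D there is p times a sign.
commonDivisor-*^2+ : ∀ {c p} M r .{{_ : NonZero M}} → Prime p → p ∤ M →
  CommonDivisor c (M * p ^ (2+ r)) → c ∣ p
commonDivisor-*^2+ {c} {p} M r pr p∤M c∣D =
  ℤ.∣⇒∣ᵤ (∣-cancel-unit (+ p) (U M d) ∣U∣≡1 (subst (+ c ℤ.∣_) entry (c∣D {d * p ^ 0} (∣m⇒∣m*n′ d∣M))))
  where
  d : ℕ
  d = proj₁ (∃-unitEntry M)
  d∣M : d ∣ M
  d∣M = proj₁ (proj₂ (∃-unitEntry M))
  ∣U∣≡1 : ℤ.∣ U M d ∣ ≡ 1
  ∣U∣≡1 = proj₂ (proj₂ (∃-unitEntry M))
  open ≡-Reasoning
  ∣m⇒∣m*n′ : d ∣ M → d * p ^ 0 ∣ M * p ^ (2+ r)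
  ∣m⇒∣m*n′ d∣M = *-pres-∣ d∣M (1∣ _)
  entry : D (M * p ^ (2+ r)) (d * p ^ 0) ≡ + p ℤ.* U M d
  entry = begin
    D (M * p ^ (2+ r)) (d * p ^ 0)
      ≡⟨ D-*^ (suc r) 0 pr p∤M d∣M ⟩
    + p ℤ.* U M d ℤ.- Υʳ p (2+ r) 0 ℤ.* W M d
      ≡⟨ cong (λ z → + p ℤ.* U M d ℤ.- z ℤ.* W M d) (Υʳ-< p (2+ r) {0} (s≤s (s≤s z≤n))) ⟩
    + p ℤ.* U M d ℤ.- 0ℤ
      ≡⟨ ℤ.+-identityʳ _ ⟩
    + p ℤ.* U M d ∎

-- Now row 1 misses the right column as well, and its left factor is -1, so an entry of D is itself
-- a sign.
commonDivisor-*^3+ : ∀ {c p} M r .{{_ : NonZero M}} → Prime p → p ∤ M →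
  CommonDivisor c (M * p ^ (3 + r)) → c ∣ 1
commonDivisor-*^3+ {c} {p} M r pr p∤M c∣D =
  ℤ.∣⇒∣ᵤ { + c} { -1ℤ} (∣-cancel-unit -1ℤ (U M d) ∣U∣≡1
  (subst (+ c ℤ.∣_) entry (c∣D {d * p ^ 1} (*-pres-∣ d∣M (^-monoʳ-∣ p {1} {3 + r} (s≤s z≤n))))))
  where
  d : ℕ
  d = proj₁ (∃-unitEntry M)
  d∣M : d ∣ M
  d∣M = proj₁ (proj₂ (∃-unitEntry M))
  ∣U∣≡1 : ℤ.∣ U M d ∣ ≡ 1
  ∣U∣≡1 = proj₂ (proj₂ (∃-unitEntry M))
  open ≡-Reasoning
  entry : D (M * p ^ (3 + r)) (d * p ^ 1) ≡ -1ℤ ℤ.* U M d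
  entry = begin
    D (M * p ^ (3 + r)) (d * p ^ 1)
      ≡⟨ D-*^ (2+ r) 1 pr p∤M d∣M ⟩
    -1ℤ ℤ.* U M d ℤ.- Υʳ p (3 + r) 1 ℤ.* W M d
      ≡⟨ cong (λ z → -1ℤ ℤ.* U M d ℤ.- z ℤ.* W M d) (Υʳ-< p (3 + r) {1} (s≤s (s≤s (s≤s z≤n)))) ⟩
    -1ℤ ℤ.* U M d ℤ.- 0ℤ
      ≡⟨ ℤ.+-identityʳ _ ⟩
    -1ℤ ℤ.* U M d ∎

data SquarePart (p : ℕ) : ℕ → Set where
  part² : ∀ M r .{{_ : NonZero M}} → p ∤ M → SquarePart p (M * p ^ (2+ r))

squarePart : ∀ {p n} .{{_ : NonZero n}} → Prime p → p ^ 2 ∣ n → SquarePart p n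
squarePart {p} {n} pr p²∣n with split (prime>1 pr) n
... | M , k , refl , p∤M with ^∣⇒≤exponent {j = 2} k pr p∤M p²∣n
...   | s≤s (s≤s {n = r} _) = part² M r {{m*n≢0⇒m≢0 M}} p∤M

commonDivisor-square : ∀ {c p} N .{{_ : NonZero N}} → Prime p → p ^ 2 ∣ N → CommonDivisor c N → c ∣ p
commonDivisor-square {c} {p} N pr p²∣N = helper (squarePart pr p²∣N)
  where
  helper : ∀ {N} → SquarePart p N → CommonDivisor c N → c ∣ p
  helper (part² M r p∤M) = commonDivisor-*^2+ M r pr p∤M

commonDivisor-cube : ∀ {c p} N .{{_ : NonZero N}} → Prime p → p ^ 3 ∣ N → CommonDivisor c N → c ∣ 1
commonDivisor-cube {c} {p} N pr p³∣N = helper (squarePart pr (∣-trans (^-monoʳ-∣ p {2} {3} (s≤s (s≤s z≤n))) p³∣N)) p³∣N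
  where
  helper : ∀ {N} → SquarePart p N → p ^ 3 ∣ N → CommonDivisor c N → c ∣ 1
  helper (part² M zero    p∤M) p³∣N _ with ^∣⇒≤exponent {j = 3} 2 pr p∤M p³∣N
  ... | s≤s (s≤s ())
  helper (part² M (suc r) p∤M) _ = commonDivisor-*^3+ M r pr p∤M

-- Squarefree levels

AllExponents1 : ℕ → Set
AllExponents1 N = ∀ {p} → p ∈ primeDivisors N → val p N ≡ 1

squarefree⇒exponents1 : ∀ N .{{_ : NonZero N}} → Squarefree N → AllExponents1 N
squarefree⇒exponents1 N sf {p} p∈ with ∈-primeDivisors⁻ N p∈
... | pr , p∣N with primePart pr p∣N
...   | part M zero    p∤M = val-*^ 1 (prime>1 pr) p∤M
...   | part M (suc r) p∤M = contradiction (∣n⇒∣m*n M (^-monoʳ-∣ p {2} {2+ r} (s≤s (s≤s z≤n)))) (sf p pr)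

exponents1-* : ∀ {p} M r .{{_ : NonZero M}} → Prime p → p ∤ M →
  AllExponents1 (M * p ^ suc r) → AllExponents1 M
exponents1-* {p} M r pr p∤M ones {q} q∈ with ∈-primeDivisors⁻ M q∈
... | qr , q∣M = trans (sym (val-*^-other M (suc r) pr qr λ { refl → p∤M q∣M }))
                   (ones (∈-resp-↭ (↭-sym (primeDivisors-*^ r pr p∤M)) (there q∈)))

ω : ℕ → ℕ
ω N = length (primeDivisors N)

-- The sign is written -(-1)^ω instead of +(-1)^(ω-1) so that N = 1 is included: there the condition
-- is vacuous, matching 𝔤(1) = 0. This value occurs for levels p².
SquarefreeConditions : ℕ → ℕ → Set
SquarefreeConditions c N =
  + c ℤ.∣ + N ℤ.- -1ℤ ℤ.^ ω N × (∀ {p} → p ∈ primeDivisors N → + c ℤ.∣ + (p ^ 2) ℤ.- 1ℤ)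

∏-primeDivisors : ∀ N .{{_ : NonZero N}} → AllExponents1 N → ∏ (primeDivisors N) (λ p → + p) ≡ + N
∏-primeDivisors N ones = trans
  (∏-cong (primeDivisors N) λ {p} p∈ → cong +_ (sym (trans (cong (p ^_) (ones p∈)) (^-identityʳ p))))
  (mult-^ N)

W-1 : ∀ N → AllExponents1 N → W N 1 ≡ -1ℤ ℤ.^ ω N
W-1 N ones = trans
  (∏-cong (primeDivisors N) λ {p} p∈ →
    cong₂ (Υʳ p) (ones p∈) (val-1 (proj₁ (∈-primeDivisors⁻ N p∈))))
  (∏-const -1ℤ (primeDivisors N))

U-1 : ∀ N .{{_ : NonZero N}} → AllExponents1 N → U N 1 ≡ + N
U-1 N ones = trans
  (∏-cong (primeDivisors N) λ {p} p∈ →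
    cong (Υˡ p (val p N)) (val-1 (proj₁ (∈-primeDivisors⁻ N p∈))))
  (∏-primeDivisors N ones)

-- The entry at 1 is N - (-1)^ω. For N = M p, the contributions of `U` cancel in the entry at 1 plus
-- p times the entry at p, leaving (1 - p²) W_M(1), where W_M(1) is a sign.
commonDivisor⇒conditions : ∀ {c} N .{{_ : NonZero N}} → AllExponents1 N →
  CommonDivisor c N → SquarefreeConditions c N
commonDivisor⇒conditions {c} N ones c∣D =
  subst (+ c ℤ.∣_) (cong₂ ℤ._-_ (U-1 N ones) (W-1 N ones)) (c∣D (1∣ N)) , λ p∈ → c∣p²-1 p∈
  where
  c∣p²-1 : ∀ {p} → p ∈ primeDivisors N → + c ℤ.∣ + (p ^ 2) ℤ.- 1ℤ
  c∣p²-1 {p} p∈ with ∈-primeDivisors⁻ N p∈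
  ... | pr , p∣N with primePart pr p∣N | ones p∈
  ...   | part M (suc r) p∤M | val≡1 =
    contradiction (trans (sym (val-*^ (2+ r) (prime>1 pr) p∤M)) val≡1) λ ()
  ...   | part M zero    p∤M | _ =
    ∣-cancel-unit (+ (p ^ 2) ℤ.- 1ℤ) (W M 1) (trans (cong ℤ.∣_∣ (W-1 M (exponents1-* M 0 pr p∤M ones))) (∣-1^n∣≡1 (ω M)))
      (subst (+ c ℤ.∣_) combination
        (ℤ.∣m⇒∣-m (ℤ.∣m∣n⇒∣m+n (c∣D (*-pres-∣ (1∣ M) (1∣ (p ^ 1))))
                               (ℤ.∣n⇒∣m*n (+ p) (c∣D (*-pres-∣ (1∣ M) (∣-refl {p ^ 1})))))))
    where
    open ≡-Reasoning
    combine : ∀ p u w → ℤ.- ((p ℤ.* u ℤ.- -1ℤ ℤ.* w) ℤ.+ p ℤ.* (-1ℤ ℤ.* u ℤ.- p ℤ.* w)) ≡ (p ℤ.* p ℤ.- 1ℤ) ℤ.* w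
    combine = ℤ-Ring.solve-∀
    combination : ℤ.- (D (M * p ^ 1) (1 * p ^ 0) ℤ.+ + p ℤ.* D (M * p ^ 1) (1 * p ^ 1))
                  ≡ (+ (p ^ 2) ℤ.- 1ℤ) ℤ.* W M 1
    combination = begin
      ℤ.- (D (M * p ^ 1) (1 * p ^ 0) ℤ.+ + p ℤ.* D (M * p ^ 1) (1 * p ^ 1))
        ≡⟨ cong₂ (λ x y → ℤ.- (x ℤ.+ + p ℤ.* y))
             (D-*^ 0 0 pr p∤M (1∣ M)) (D-*^ 0 1 pr p∤M (1∣ M)) ⟩
      ℤ.- ((+ p ℤ.* U M 1 ℤ.- -1ℤ ℤ.* W M 1) ℤ.+ + p ℤ.* (-1ℤ ℤ.* U M 1 ℤ.- + p ℤ.* W M 1))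
        ≡⟨ combine (+ p) (U M 1) (W M 1) ⟩
      (+ p ℤ.* + p ℤ.- 1ℤ) ℤ.* W M 1
        ≡⟨ cong (λ z → (z ℤ.- 1ℤ) ℤ.* W M 1)
             (trans (sym (ℤ.pos-* p p)) (cong (λ z → + (p * z)) (sym (*-identityʳ p)))) ⟩
      (+ (p ^ 2) ℤ.- 1ℤ) ℤ.* W M 1 ∎

-- Modulo c we have p² ≡ 1, so that Υʳ p 1 e ≡ - p * Υˡ p 1 e for both exponents e.
conditions⇒commonDivisor : ∀ {c} N .{{_ : NonZero N}} → AllExponents1 N →
  SquarefreeConditions c N → CommonDivisor c N
conditions⇒commonDivisor {c} N ones (c∣N-ε , c∣p²-1) {δ} δ∣N =
  subst (+ c ℤ.∣_) total (ℤ.∣m∣n⇒∣m+n (ℤ.∣n⇒∣m*n (ℤ.- (ε ℤ.* U N δ)) c∣N-ε) (ℤ.∣m⇒∣-m W≡))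
  where
  open ≡-Reasoning
  PD = primeDivisors N
  ε = -1ℤ ℤ.^ ω N
  e : ℕ → ℕ
  e p = val p δ

  ε²≡1 : ∀ n → -1ℤ ℤ.^ n ℤ.* -1ℤ ℤ.^ n ≡ 1ℤ
  ε²≡1 zero    = refl
  ε²≡1 (suc n) = trans (square (-1ℤ ℤ.^ n)) (ε²≡1 n)
    where
    square : ∀ x → -1ℤ ℤ.* x ℤ.* (-1ℤ ℤ.* x) ≡ x ℤ.* x
    square = ℤ-Ring.solve-∀

  e≤1 : ∀ {p} → p ∈ PD → e p ≤ 1
  e≤1 {p} p∈ with ∈-primeDivisors⁻ N p∈
  ... | pr , p∣N with primePart pr p∣N | ones p∈
  ...   | part M r p∤M | val≡1 with divisor-*^ (suc r) pr p∤M δ∣N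
  ...     | i , d , i≤1+r , d∣M , refl = subst₂ _≤_
    (sym (val-*^ i {{∣⇒nonZero d∣M}} (prime>1 pr) λ p∣d → p∤M (∣-trans p∣d d∣M)))
    (trans (sym (val-*^ (suc r) (prime>1 pr) p∤M)) val≡1) i≤1+r

  -- At exponent 0 the difference is exactly p² - 1, at exponent 1 it is zero.
  entry≡ : ∀ p {i} → i ≤ 1 → + c ℤ.∣ + (p ^ 2) ℤ.- 1ℤ → + c ℤ.∣ Υʳ p 1 i ℤ.- (-1ℤ ℤ.* + p) ℤ.* Υˡ p 1 i
  entry≡ p z≤n       c∣ = subst (+ c ℤ.∣_)
    (trans (cong (ℤ._- 1ℤ) (trans (cong (λ z → + (p * z)) (*-identityʳ p)) (ℤ.pos-* p p))) (solved (+ p))) c∣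
    where
    solved : ∀ x → x ℤ.* x ℤ.- 1ℤ ≡ -1ℤ ℤ.- (-1ℤ ℤ.* x) ℤ.* x
    solved = ℤ-Ring.solve-∀
  entry≡ p (s≤s z≤n) c∣ = ℤ.divides 0ℤ (solved (+ p))
    where
    solved : ∀ x → x ℤ.- (-1ℤ ℤ.* x) ℤ.* -1ℤ ≡ 0ℤ
    solved = ℤ-Ring.solve-∀

  ∏≡ : ∏ PD (λ p → (-1ℤ ℤ.* + p) ℤ.* Υˡ p (val p N) (e p)) ≡ ε ℤ.* + N ℤ.* U N δ
  ∏≡ = begin
    ∏ PD (λ p → (-1ℤ ℤ.* + p) ℤ.* Υˡ p (val p N) (e p))
      ≡⟨ ∏-* (λ p → -1ℤ ℤ.* + p) (λ p → Υˡ p (val p N) (e p)) PD ⟩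
    ∏ PD (λ p → -1ℤ ℤ.* + p) ℤ.* U N δ
      ≡⟨ cong (λ z → z ℤ.* U N δ) (∏-* (λ _ → -1ℤ) (λ p → + p) PD) ⟩
    ∏ PD (λ _ → -1ℤ) ℤ.* ∏ PD (λ p → + p) ℤ.* U N δ
      ≡⟨ cong₂ (λ x y → x ℤ.* y ℤ.* U N δ) (∏-const -1ℤ PD) (∏-primeDivisors N ones) ⟩
    ε ℤ.* + N ℤ.* U N δ ∎

  W≡ : + c ℤ.∣ W N δ ℤ.- ε ℤ.* + N ℤ.* U N δ
  W≡ = subst (λ z → + c ℤ.∣ W N δ ℤ.- z) ∏≡ (∏-cong-mod PD λ {p} p∈ →
    subst (λ r → + c ℤ.∣ Υʳ p r (e p) ℤ.- (-1ℤ ℤ.* + p) ℤ.* Υˡ p r (e p)) (sym (ones p∈))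
      (entry≡ p (e≤1 p∈) (c∣p²-1 p∈)))

  -- Modulo `c`, W ≡ ε N U and N ≡ ε, hence W ≡ ε² U = U.
  total : ℤ.- (ε ℤ.* U N δ) ℤ.* (+ N ℤ.- ε) ℤ.+ ℤ.- (W N δ ℤ.- ε ℤ.* + N ℤ.* U N δ) ≡ D N δ
  total = begin
    ℤ.- (ε ℤ.* U N δ) ℤ.* (+ N ℤ.- ε) ℤ.+ ℤ.- (W N δ ℤ.- ε ℤ.* + N ℤ.* U N δ)
      ≡⟨ solved ε (U N δ) (W N δ) (+ N) ⟩
    ε ℤ.* ε ℤ.* U N δ ℤ.- W N δ
      ≡⟨ cong (λ z → z ℤ.* U N δ ℤ.- W N δ) (ε²≡1 (ω N)) ⟩
    1ℤ ℤ.* U N δ ℤ.- W N δ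
      ≡⟨ cong (λ z → z ℤ.- W N δ) (ℤ.*-identityˡ (U N δ)) ⟩
    D N δ ∎
    where
    solved : ∀ ε u w n → ℤ.- (ε ℤ.* u) ℤ.* (n ℤ.- ε) ℤ.+ ℤ.- (w ℤ.- ε ℤ.* n ℤ.* u) ≡ ε ℤ.* ε ℤ.* u ℤ.- w
    solved = ℤ-Ring.solve-∀

-- The equality GCD(C_N) = 𝔤(N)

gcd-unique : ∀ {a b} → (∀ {c} → c ∣ a → c ∣ b) → (∀ {c} → c ∣ b → c ∣ a) → a ≡ b
gcd-unique to from = ∣-antisym (to ∣-refl) (from ∣-refl)

primeDivisors≢[] : ∀ {N} → 1 < N → ∃[ t ] ω N ≡ suc t
primeDivisors≢[] {N} 1<N with primeDivisors N in eq | ∃-primeDivisor N 1<N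
... | _ ∷ ps | _ = length ps , refl
... | []     | p , pr , p∣N =
  contradiction (subst (p ∈_) eq (∈-primeDivisors⁺ {{>-nonZero (<⇒≤ 1<N)}} pr p∣N)) λ ()

-- The truncated ω ∸ 1 in `𝔤-squarefree` is a true predecessor only when N has a prime factor.
sign-shift : ∀ n {ω} t → ω ≡ suc t → n ℤ.- -1ℤ ℤ.^ ω ≡ n ℤ.+ -1ℤ ℤ.^ (ω ∸ 1)
sign-shift n t refl = cong (λ z → n ℤ.+ z)
  (trans (cong ℤ.-_ (ℤ.-1*i≡-i (-1ℤ ℤ.^ t))) (ℤ.neg-involutive (-1ℤ ℤ.^ t)))

∣𝔤-squarefree⁺ : ∀ {c} N .{{_ : NonZero N}} → SquarefreeConditions c N → c ∣ 𝔤-squarefree N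
∣𝔤-squarefree⁺ {c} 1          _ = c ∣0
∣𝔤-squarefree⁺ {c} N@(2+ _) (c∣N-ε , c∣p²-1) with primeDivisors≢[] {N} (s≤s (s≤s z≤n))
... | t , ω≡ = gcd-greatest (ℤ.∣⇒∣ᵤ (subst (+ c ℤ.∣_) (sign-shift (+ N) t ω≡) c∣N-ε))
                            (∣gcdℤ-map⁺ (primeDivisors N) c∣p²-1)

∣𝔤-squarefree⁻ : ∀ {c} N .{{_ : NonZero N}} → c ∣ 𝔤-squarefree N → SquarefreeConditions c N
∣𝔤-squarefree⁻ {c} 1          _ = ℤ.divides 0ℤ refl , λ ()
∣𝔤-squarefree⁻ {c} N@(2+ _) c∣ with primeDivisors≢[] {N} (s≤s (s≤s z≤n))
... | t , ω≡ =
  subst (+ c ℤ.∣_) (sym (sign-shift (+ N) t ω≡)) (ℤ.∣ᵤ⇒∣ (∣-trans c∣ (gcd[m,n]∣m ℤ.∣ x ∣ y)))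
  , ∣gcdℤ-map⁻ (∣-trans c∣ (gcd[m,n]∣n ℤ.∣ x ∣ y))
  where
  x = + N ℤ.+ -1ℤ ℤ.^ (ω N ∸ 1)
  y = gcdℤ (map (λ p → + (p ^ 2) ℤ.- 1ℤ) (primeDivisors N))

-- When the exponent of p is exactly 2, row 1 is adjacent to both outer columns: both local factors
-- are -1, and the entry is minus the one for `M`.
commonDivisor-*² : ∀ {c p} M .{{_ : NonZero M}} → Prime p → p ∤ M →
  CommonDivisor c (M * p ^ 2) → CommonDivisor c M
commonDivisor-*² {c} {p} M pr p∤M c∣D {d} d∣M = subst (+ c ℤ.∣_) entry
  (ℤ.∣m⇒∣-m (c∣D {d * p ^ 1} (*-pres-∣ d∣M (^-monoʳ-∣ p {1} {2} (s≤s z≤n)))))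
  where
  negate : ∀ u w → ℤ.- (-1ℤ ℤ.* u ℤ.- -1ℤ ℤ.* w) ≡ u ℤ.- w
  negate = ℤ-Ring.solve-∀
  entry : ℤ.- D (M * p ^ 2) (d * p ^ 1) ≡ D M d
  entry = trans (cong ℤ.-_ (D-*^ 1 1 pr p∤M d∣M)) (negate (U M d) (W M d))

-- Rows 0 and 2 meet one outer column in the diagonal entry p and the other in 0, so their entries
-- are multiples of p; row 1 gives the entries for `M` up to sign.
commonDivisor-*²⁺ : ∀ {c p} M .{{_ : NonZero M}} → Prime p → p ∤ M →
  c ∣ p → CommonDivisor c M → CommonDivisor c (M * p ^ 2)
commonDivisor-*²⁺ {c} {p} M pr p∤M c∣p c∣D {δ} δ∣N = helper (divisor-*^ 2 pr p∤M δ∣N)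
  where
  c∣+p : + c ℤ.∣ + p
  c∣+p = ℤ.∣ᵤ⇒∣ c∣p
  first : ∀ p u w → p ℤ.* u ≡ p ℤ.* u ℤ.- 0ℤ ℤ.* w
  first = ℤ-Ring.solve-∀
  middle : ∀ u w → ℤ.- (u ℤ.- w) ≡ -1ℤ ℤ.* u ℤ.- -1ℤ ℤ.* w
  middle = ℤ-Ring.solve-∀
  last : ∀ p u w → p ℤ.* ℤ.- w ≡ 0ℤ ℤ.* u ℤ.- p ℤ.* w
  last = ℤ-Ring.solve-∀
  entry : ∀ {e d} → e ≤ 2 → d ∣ M → + c ℤ.∣ Υˡ p 2 e ℤ.* U M d ℤ.- Υʳ p 2 e ℤ.* W M d
  entry {d = d} z≤n             d∣M = subst (+ c ℤ.∣_) (first (+ p) (U M d) (W M d)) (ℤ.∣m⇒∣m*n (U M d) c∣+p)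
  entry {d = d} (s≤s z≤n)       d∣M = subst (+ c ℤ.∣_) (middle (U M d) (W M d)) (ℤ.∣m⇒∣-m (c∣D d∣M))
  entry {d = d} (s≤s (s≤s z≤n)) d∣M = subst (+ c ℤ.∣_) (last (+ p) (U M d) (W M d)) (ℤ.∣m⇒∣m*n (ℤ.- W M d) c∣+p)
  helper : ∃[ e ] ∃[ d ] e ≤ 2 × d ∣ M × δ ≡ d * p ^ e → + c ℤ.∣ D (M * p ^ 2) δ
  helper (e , d , e≤2 , d∣M , refl) = subst (+ c ℤ.∣_) (sym (D-*^ 1 e pr p∤M d∣M)) (entry e≤2 d∣M)

¬squarefree⇒ : ∀ N .{{_ : NonZero N}} → ¬ Squarefree N → ∃[ p ] Prime p × p ^ 2 ∣ N
¬squarefree⇒ N ¬sf with anyUpTo? (λ p → prime? p ×-dec p ^ 2 ∣? N) (suc N)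
... | yes (p , _ , pr , p²∣N) = p , pr , p²∣N
... | no none = contradiction
  (λ p pr p²∣N → none (p , s≤s (∣⇒≤ (∣-trans (m∣m*n (p ^ 1)) p²∣N)) , pr , p²∣N)) ¬sf

∣two-primes⇒∣1 : ∀ {c p q} → Prime p → Prime q → p ≢ q → c ∣ p → c ∣ q → c ∣ 1
∣two-primes⇒∣1 {c} pr qr p≢q c∣p c∣q with prime⇒irreducible pr c∣p
... | inj₁ c≡1  = ∣-reflexive c≡1
... | inj₂ refl = contradiction (prime∣prime⇒≡ pr qr c∣q) p≢q

p∤⇒coprime : ∀ {p M} → Prime p → p ∤ M → Coprime M p
p∤⇒coprime {p} {M} pr p∤M {i} (i∣M , i∣p) =
  [ id , (λ i≡p → contradiction (subst (_∣ M) i≡p i∣M) p∤M) ]′ (prime⇒irreducible pr i∣p)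

coprime⇒p∤ : ∀ {p M} → Prime p → Coprime M p → p ∤ M
coprime⇒p∤ pr M⊥p p∣M = contradiction (subst Prime (M⊥p (p∣M , ∣-refl)) pr) ¬prime[1]

-- Either a cube divides N, or the squares of two distinct primes do; in the latter case `c` divides
-- both primes.
commonDivisor-otherwise : ∀ {c} N .{{_ : NonZero N}} → ¬ Squarefree N → ¬ SquarefreeTimesSquare N →
  CommonDivisor c N → c ∣ 1
commonDivisor-otherwise {c} N ¬sf ¬sfts c∣D with ¬squarefree⇒ N ¬sf
... | p , pr , p²∣N = helper (squarePart pr p²∣N) ¬sfts (commonDivisor-square N pr p²∣N c∣D) c∣D
  where
  helper : ∀ {N} .{{_ : NonZero N}} → SquarePart p N → ¬ SquarefreeTimesSquare N → c ∣ p →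
    CommonDivisor c N → c ∣ 1
  helper {N} (part² M (suc r) p∤M) ¬sfts c∣p c∣D =
    commonDivisor-cube N pr (∣n⇒∣m*n M (^-monoʳ-∣ p {3} {3 + r} (s≤s (s≤s (s≤s z≤n))))) c∣D
  helper {N} (part² M zero p∤M)    ¬sfts c∣p c∣D
    with ¬squarefree⇒ M (λ sf → ¬sfts (p , M , pr , refl , p∤⇒coprime pr p∤M , sf))
  ... | q , qr , q²∣M = ∣two-primes⇒∣1 pr qr p≢q c∣p (commonDivisor-square N qr (∣m⇒∣m*n (p ^ 2) q²∣M) c∣D)
    where
    p≢q : p ≢ q
    p≢q refl = p∤M (∣-trans (m∣m*n (p ^ 1)) q²∣M)

commonDivisor⇒∣𝔤-*² : ∀ {c p M N} .{{_ : NonZero N}} → Prime p → N ≡ M * p ^ 2 → Coprime M p → Squarefree M →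
  CommonDivisor c N → c ∣ gcd p (𝔤-squarefree M)
commonDivisor⇒∣𝔤-*² {c} {p} {M} pr refl M⊥p sf c∣D = gcd-greatest
  (commonDivisor-square (M * p ^ 2) pr (n∣m*n M) c∣D)
  (∣𝔤-squarefree⁺ M (commonDivisor⇒conditions M (squarefree⇒exponents1 M sf) (commonDivisor-*² M pr p∤M c∣D)))
  where
  instance
    M≢0 : NonZero M
    M≢0 = m*n≢0⇒m≢0 M
  p∤M : p ∤ M
  p∤M = coprime⇒p∤ pr M⊥p

∣𝔤-*²⇒commonDivisor : ∀ {c p M N} .{{_ : NonZero N}} → Prime p → N ≡ M * p ^ 2 → Coprime M p → Squarefree M →
  c ∣ gcd p (𝔤-squarefree M) → CommonDivisor c N
∣𝔤-*²⇒commonDivisor {c} {p} {M} pr refl M⊥p sf c∣ = commonDivisor-*²⁺ M pr (coprime⇒p∤ pr M⊥p)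
  (∣-trans c∣ (gcd[m,n]∣m p (𝔤-squarefree M)))
  (conditions⇒commonDivisor M (squarefree⇒exponents1 M sf)
    (∣𝔤-squarefree⁻ M (∣-trans c∣ (gcd[m,n]∣n p (𝔤-squarefree M)))))
  where
  instance
    M≢0 : NonZero M
    M≢0 = m*n≢0⇒m≢0 M

∣𝔤⁺ : ∀ {c} N .{{_ : NonZero N}} → CommonDivisor c N → c ∣ 𝔤 N
∣𝔤⁺ {c} N@(suc _) c∣D with squarefree? N
... | yes sf = ∣𝔤-squarefree⁺ N (commonDivisor⇒conditions N (squarefree⇒exponents1 N sf) c∣D)
... | no ¬sf with squarefreeTimesSquare? N
...   | no ¬sfts = commonDivisor-otherwise N ¬sf ¬sfts c∣D
...   | yes (p , M , pr , N≡ , M⊥p , sf) = commonDivisor⇒∣𝔤-*² pr N≡ M⊥p sf c∣D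

∣𝔤⁻ : ∀ {c} N .{{_ : NonZero N}} → c ∣ 𝔤 N → CommonDivisor c N
∣𝔤⁻ {c} N@(suc _) c∣𝔤 with squarefree? N
... | yes sf = conditions⇒commonDivisor N (squarefree⇒exponents1 N sf) (∣𝔤-squarefree⁻ N c∣𝔤)
... | no ¬sf with squarefreeTimesSquare? N
...   | no ¬sfts = λ _ → ℤ.∣ᵤ⇒∣ (∣-trans c∣𝔤 (1∣ _))
...   | yes (p , M , pr , N≡ , M⊥p , sf) = ∣𝔤-*²⇒commonDivisor pr N≡ M⊥p sf c∣𝔤

GCD≡𝔤 : ∀ N → 1 < N → GCD N C⟨ N ⟩ ≡ 𝔤 N
GCD≡𝔤 N 1<N = gcd-unique (λ c∣ → ∣𝔤⁺ N (∣GCD⁻ 1<N c∣)) (λ c∣ → ∣GCD⁺ 1<N (∣𝔤⁻ N c∣))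
  where instance _ = >-nonZero (<⇒≤ 1<N)

-- The invariants Pw_p(C_N)

/₀-exact : ∀ i g → + g ℤ.∣ i → (i /₀ g) ℤ.* + g ≡ i
-- Zero divides only zero, which agrees with the default value of `/₀`.
/₀-exact i zero      0∣i = sym (ℤ.0∣⇒≡0 0∣i)
/₀-exact i g@(suc _) g∣i = sym (begin
  i                                       ≡⟨ ℤ.a≡a%ℕn+[a/ℕn]*n i g ⟩
  + (i ℤ.%ℕ g) ℤ.+ (i ℤ./ℕ g) ℤ.* + g     ≡⟨ cong (λ r → + r ℤ.+ (i ℤ./ℕ g) ℤ.* + g) i%g≡0 ⟩
  0ℤ ℤ.+ (i ℤ./ℕ g) ℤ.* + g               ≡⟨ ℤ.+-identityˡ _ ⟩
  (i ℤ./ℕ g) ℤ.* + g                      ∎)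
  where
  open ≡-Reasoning
  g∣i%g : g ∣ i ℤ.%ℕ g
  g∣i%g = ℤ.∣⇒∣ᵤ (ℤ.∣m+n∣n⇒∣m {m = + (i ℤ.%ℕ g)}
    (subst (+ g ℤ.∣_) (ℤ.a≡a%ℕn+[a/ℕn]*n i g) g∣i) (ℤ.∣n⇒∣m*n (i ℤ./ℕ g) ℤ.∣-refl))
  i%g≡0 : i ℤ.%ℕ g ≡ 0
  i%g≡0 = trans (sym (m<n⇒m%n≡m (ℤ.n%ℕd<d i g))) (n∣m⇒m%n≡0 (i ℤ.%ℕ g) g g∣i%g)

-- Sums over odd exponents

odd : ℕ → ℤ
odd e = if does (¬? (2 ∣? e)) then 1ℤ else 0ℤ

odd≡1 : ∀ {e} → 2 ∤ e → odd e ≡ 1ℤ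
odd≡1 {e} 2∤e = cong (λ b → if b then 1ℤ else 0ℤ) (dec-true (¬? (2 ∣? e)) 2∤e)

odd≡0 : ∀ {e} → 2 ∣ e → odd e ≡ 0ℤ
odd≡0 {e} 2∣e = cong (λ b → if b then 1ℤ else 0ℤ) (dec-false (¬? (2 ∣? e)) λ 2∤e → 2∤e 2∣e)

2∤n⇒2∣1+n : ∀ {n} → 2 ∤ n → 2 ∣ suc n
2∤n⇒2∣1+n {zero}        2∤n = contradiction (2 ∣0) 2∤n
2∤n⇒2∣1+n {suc zero}    2∤n = ∣-refl
2∤n⇒2∣1+n {suc (suc n)} 2∤n = ∣m∣n⇒∣m+n ∣-refl (2∤n⇒2∣1+n λ 2∣n → 2∤n (∣m∣n⇒∣m+n ∣-refl 2∣n))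

2∣n⇒2∤1+n : ∀ {n} → 2 ∣ n → 2 ∤ suc n
2∣n⇒2∤1+n {n} 2∣n 2∣1+n = contradiction (∣m+n∣m⇒∣n (subst (2 ∣_) (+-comm 1 n) 2∣1+n) 2∣n) λ 2∣1 → case ∣1⇒≡1 2∣1 of λ ()

2∤1+n⇒2∣n : ∀ {n} → 2 ∤ suc n → 2 ∣ n
2∤1+n⇒2∣n {n} 2∤1+n with 2 ∣? n
... | yes 2∣n = 2∣n
... | no  2∤n = contradiction (2∤n⇒2∣1+n 2∤n) 2∤1+n

∑-first-two : ∀ (g : ℕ → ℤ) r → (∀ i → g (2+ i) ≡ 0ℤ) → ∑ (upTo (2+ r)) g ≡ g 0 ℤ.+ g 1
∑-first-two g r g≡0 = cong (λ z → g 0 ℤ.+ z) (trans (cong (λ z → g 1 ℤ.+ z) tail) (ℤ.+-identityʳ (g 1)))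
  where
  tail : ∑ (applyUpTo 2+ r) g ≡ 0ℤ
  tail = ∑-zero (applyUpTo 2+ r) λ x∈ → case ∈-applyUpTo⁻ 2+ x∈ of λ { (i , _ , refl) → g≡0 i }

∑-upTo-suc : ∀ (g : ℕ → ℤ) n → ∑ (upTo (suc n)) g ≡ ∑ (upTo n) g ℤ.+ g n
∑-upTo-suc g n = begin
  ∑ (upTo (suc n)) g              ≡⟨ cong (λ xs → ∑ xs g) (upTo-∷ʳ n) ⟨
  ∑ (upTo n ++ n ∷ []) g          ≡⟨ ∑-++ g (upTo n) (n ∷ []) ⟩
  ∑ (upTo n) g ℤ.+ (g n ℤ.+ 0ℤ)   ≡⟨ cong (λ z → ∑ (upTo n) g ℤ.+ z) (ℤ.+-identityʳ (g n)) ⟩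
  ∑ (upTo n) g ℤ.+ g n            ∎
  where open ≡-Reasoning

∑-last-two : ∀ (g : ℕ → ℤ) r → (∀ {i} → i < r → g i ≡ 0ℤ) → ∑ (upTo (2+ r)) g ≡ g r ℤ.+ g (suc r)
∑-last-two g r g≡0 = begin
  ∑ (upTo (2+ r)) g                     ≡⟨ ∑-upTo-suc g (suc r) ⟩
  ∑ (upTo (suc r)) g ℤ.+ g (suc r)      ≡⟨ cong (ℤ._+ g (suc r)) (∑-upTo-suc g r) ⟩
  ∑ (upTo r) g ℤ.+ g r ℤ.+ g (suc r)    ≡⟨ cong (λ z → z ℤ.+ g r ℤ.+ g (suc r)) (∑-zero (upTo r) (g≡0 ∘ ∈-upTo⁻)) ⟩
  0ℤ ℤ.+ g r ℤ.+ g (suc r)              ≡⟨ cong (ℤ._+ g (suc r)) (ℤ.+-identityˡ (g r)) ⟩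
  g r ℤ.+ g (suc r)                     ∎
  where open ≡-Reasoning

∑-Υˡ : ∀ p r → ∑ (upTo (2+ r)) (Υˡ p (suc r)) ≡ + p ℤ.- 1ℤ
∑-Υˡ p r = ∑-first-two (Υˡ p (suc r)) r λ i → refl

∑-Υʳ : ∀ p r → ∑ (upTo (2+ r)) (Υʳ p (suc r)) ≡ + p ℤ.- 1ℤ
∑-Υʳ p r = begin
  ∑ (upTo (2+ r)) (Υʳ p (suc r))         ≡⟨ ∑-last-two (Υʳ p (suc r)) r (λ i<r → Υʳ-< p (suc r) (s≤s i<r)) ⟩
  Υʳ p (suc r) r ℤ.+ Υʳ p (suc r) (suc r) ≡⟨ cong₂ ℤ._+_ (Υʳ-pred p r) (Υʳ-r p (suc r)) ⟩
  -1ℤ ℤ.+ + p                            ≡⟨ ℤ.+-comm -1ℤ (+ p) ⟩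
  + p ℤ.- 1ℤ                             ∎
  where open ≡-Reasoning

∑-odd-Υˡ : ∀ p r → ∑ (upTo (2+ r)) (λ e → odd e ℤ.* Υˡ p (suc r) e) ≡ -1ℤ
∑-odd-Υˡ p r = ∑-first-two (λ e → odd e ℤ.* Υˡ p (suc r) e) r λ i → ℤ.*-zeroʳ (odd (2+ i))

-- The right column lives on the consecutive exponents r and r + 1, exactly one of which is odd;
-- keeping both indicators treats the two parities in one formula.
∑-odd-Υʳ : ∀ p r → ∑ (upTo (2+ r)) (λ e → odd e ℤ.* Υʳ p (suc r) e) ≡ odd r ℤ.* -1ℤ ℤ.+ odd (suc r) ℤ.* + p
∑-odd-Υʳ p r = trans
  (∑-last-two (λ e → odd e ℤ.* Υʳ p (suc r) e) r
    λ {i} i<r → trans (cong (λ z → odd i ℤ.* z) (Υʳ-< p (suc r) (s≤s i<r))) (ℤ.*-zeroʳ (odd i)))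
  (cong₂ (λ x y → odd r ℤ.* x ℤ.+ odd (suc r) ℤ.* y) (Υʳ-pred p r) (Υʳ-r p (suc r)))

-- Euler's function of the radical of `M`: each local sum is q - 1 whatever the exponent of q.
φ : ℕ → ℤ
φ M = ∏ (primeDivisors M) (λ q → + q ℤ.- 1ℤ)

∑-mult≡φ : ∀ h M .{{_ : NonZero M}} → (∀ p r → ∑ (upTo (2+ r)) (h p (suc r)) ≡ + p ℤ.- 1ℤ) →
  ∑ (divisors M) (mult h M) ≡ φ M
∑-mult≡φ h M ∑h = trans (∑-mult h M) (∏-cong (primeDivisors M) λ {q} q∈ →
  let qr , q∣M = ∈-primeDivisors⁻ M q∈ in local q (∣⇒1≤val qr q∣M))
  where
  local : ∀ q {r} → 1 ≤ r → ∑ (upTo (suc r)) (h q r) ≡ + q ℤ.- 1ℤ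
  local q {suc r} _ = ∑h q r

-- The parity condition concerns only the exponent of p, so the sum over the divisors of `M` is
-- complete.
∑-odd-mult : ∀ h {p} M r .{{_ : NonZero M}} → Prime p → p ∤ M →
  (∀ p r → ∑ (upTo (2+ r)) (h p (suc r)) ≡ + p ℤ.- 1ℤ) →
  ∑ (divisors (M * p ^ suc r)) (λ δ → odd (val p δ) ℤ.* mult h (M * p ^ suc r) δ)
    ≡ ∑ (upTo (2+ r)) (λ e → odd e ℤ.* h p (suc r) e) ℤ.* φ M
∑-odd-mult h {p} M r pr p∤M ∑h = trans
  (∑-divisors-*^ (suc r) pr p∤M _ (mult h M) (λ e → odd e ℤ.* h p (suc r) e)
    λ {e} {d} _ d∣M → trans
      (cong₂ ℤ._*_ (cong odd (val-*^ e {{∣⇒nonZero d∣M}} (prime>1 pr) λ p∣d → p∤M (∣-trans p∣d d∣M)))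
                   (mult-*^ h r e pr p∤M d∣M))
      (sym (ℤ.*-assoc (odd e) (h p (suc r) e) (mult h M d))))
  (cong (λ z → ∑ (upTo (2+ r)) (λ e → odd e ℤ.* h p (suc r) e) ℤ.* z) (∑-mult≡φ h M ∑h))

Pw≡∑ : ∀ N C p → Pw N C p ≡ ∑ (divisors N) (λ δ → odd (val p δ) ℤ.* 𝕍 N C δ)
Pw≡∑ N C p = ∑-filter (λ δ → ¬? (2 ∣? val p δ)) (𝕍 N C) (divisors N)

-- Multiplying by the GCD clears the division in `𝕍`.
GCD*Pw : ∀ N p → 1 < N → + GCD N C⟨ N ⟩ ℤ.* Pw N C⟨ N ⟩ p ≡ ∑ (divisors N) (λ δ → odd (val p δ) ℤ.* D N δ)
GCD*Pw N p 1<N = begin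
  + G ℤ.* Pw N C⟨ N ⟩ p
    ≡⟨ cong (λ z → + G ℤ.* z) (Pw≡∑ N C⟨ N ⟩ p) ⟩
  + G ℤ.* ∑ (divisors N) (λ δ → odd (val p δ) ℤ.* 𝕍 N C⟨ N ⟩ δ)
    ≡⟨ ∑-distribˡ-* (+ G) (λ δ → odd (val p δ) ℤ.* 𝕍 N C⟨ N ⟩ δ) (divisors N) ⟨
  ∑ (divisors N) (λ δ → + G ℤ.* (odd (val p δ) ℤ.* 𝕍 N C⟨ N ⟩ δ))
    ≡⟨ ∑-cong (divisors N) (λ {δ} δ∈ → trans (rearrange (+ G) (odd (val p δ)) (𝕍 N C⟨ N ⟩ δ))
         (cong (λ z → odd (val p δ) ℤ.* z) (exact δ∈))) ⟩
  ∑ (divisors N) (λ δ → odd (val p δ) ℤ.* D N δ) ∎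
  where
  open ≡-Reasoning
  G = GCD N C⟨ N ⟩
  rearrange : ∀ a b c → a ℤ.* (b ℤ.* c) ≡ b ℤ.* (c ℤ.* a)
  rearrange = ℤ-Ring.solve-∀
  exact : ∀ {δ} → δ ∈ divisors N → 𝕍 N C⟨ N ⟩ δ ℤ.* + G ≡ D N δ
  exact {δ} δ∈ = trans
    (/₀-exact (V N C⟨ N ⟩ δ) G (∣gcdℤ-map⁻ {xs = divisors N} ∣-refl δ∈))
    (V≡D N δ 1<N)

GCD*Pw-*^ : ∀ {p} M r .{{_ : NonZero M}} → Prime p → p ∤ M →
  let N = M * p ^ suc r in
  + GCD N C⟨ N ⟩ ℤ.* Pw N C⟨ N ⟩ p ≡ (-1ℤ ℤ.- (odd r ℤ.* -1ℤ ℤ.+ odd (suc r) ℤ.* + p)) ℤ.* φ M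
GCD*Pw-*^ {p} M r pr p∤M = begin
  + GCD N C⟨ N ⟩ ℤ.* Pw N C⟨ N ⟩ p
    ≡⟨ GCD*Pw N p 1<N ⟩
  ∑ (divisors N) (λ δ → odd (val p δ) ℤ.* D N δ)
    ≡⟨ ∑-cong (divisors N) (λ {δ} _ → distrib (odd (val p δ)) (U N δ) (W N δ)) ⟩
  ∑ (divisors N) (λ δ → odd (val p δ) ℤ.* U N δ ℤ.- odd (val p δ) ℤ.* W N δ)
    ≡⟨ ∑-distrib-- (λ δ → odd (val p δ) ℤ.* U N δ) (λ δ → odd (val p δ) ℤ.* W N δ) (divisors N) ⟩
  ∑ (divisors N) (λ δ → odd (val p δ) ℤ.* U N δ) ℤ.- ∑ (divisors N) (λ δ → odd (val p δ) ℤ.* W N δ)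
    ≡⟨ cong₂ ℤ._-_ (∑-odd-mult Υˡ M r pr p∤M ∑-Υˡ) (∑-odd-mult Υʳ M r pr p∤M ∑-Υʳ) ⟩
  ∑ (upTo (2+ r)) (λ e → odd e ℤ.* Υˡ p (suc r) e) ℤ.* φ M ℤ.- ∑ (upTo (2+ r)) (λ e → odd e ℤ.* Υʳ p (suc r) e) ℤ.* φ M
    ≡⟨ cong₂ (λ x y → x ℤ.* φ M ℤ.- y ℤ.* φ M) (∑-odd-Υˡ p r) (∑-odd-Υʳ p r) ⟩
  -1ℤ ℤ.* φ M ℤ.- w ℤ.* φ M
    ≡⟨ factor -1ℤ w (φ M) ⟩
  (-1ℤ ℤ.- w) ℤ.* φ M ∎
  where
  open ≡-Reasoning
  N = M * p ^ suc r
  w = odd r ℤ.* -1ℤ ℤ.+ odd (suc r) ℤ.* + p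
  1<N : 1 < N
  1<N = <-≤-trans (≤-<-trans (s≤s z≤n) (n<p^n (prime>1 pr) (suc r))) (m≤n*m (p ^ suc r) M)
  distrib : ∀ x y z → x ℤ.* (y ℤ.- z) ≡ x ℤ.* y ℤ.- x ℤ.* z
  distrib = ℤ-Ring.solve-∀
  factor : ∀ x y z → x ℤ.* z ℤ.- y ℤ.* z ≡ (x ℤ.- y) ℤ.* z
  factor = ℤ-Ring.solve-∀

totients : List ℕ → ℕ
totients ps = product (map pred ps)

∣φ∣ : ∀ M → ℤ.∣ φ M ∣ ≡ totients (primeDivisors M)
∣φ∣ M = go (primeDivisors M) (λ q∈ → proj₁ (∈-primeDivisors⁻ M q∈))
  where
  ∣n-1∣ : ∀ n .{{_ : NonZero n}} → ℤ.∣ + n ℤ.- 1ℤ ∣ ≡ pred n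
  ∣n-1∣ (suc n) = refl
  go : ∀ ps → (∀ {q} → q ∈ ps → Prime q) → ℤ.∣ ∏ ps (λ q → + q ℤ.- 1ℤ) ∣ ≡ totients ps
  go []       _  = refl
  go (q ∷ ps) pr = trans (ℤ.abs-* (+ q ℤ.- 1ℤ) _)
    (cong₂ _*_ (∣n-1∣ q {{prime⇒nonZero (pr (here refl))}}) (go ps (pr ∘ there)))

∣Pw∣*GCD : ∀ {p} M r .{{_ : NonZero M}} → Prime p → p ∤ M → 2 ∤ suc r →
  let N = M * p ^ suc r in
  ℤ.∣ Pw N C⟨ N ⟩ p ∣ * GCD N C⟨ N ⟩ ≡ suc p * totients (primeDivisors M)
∣Pw∣*GCD {p} M r pr p∤M 2∤1+r = begin
  ℤ.∣ Pw N C⟨ N ⟩ p ∣ * GCD N C⟨ N ⟩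
    ≡⟨ *-comm ℤ.∣ Pw N C⟨ N ⟩ p ∣ (GCD N C⟨ N ⟩) ⟩
  GCD N C⟨ N ⟩ * ℤ.∣ Pw N C⟨ N ⟩ p ∣
    ≡⟨ ℤ.abs-* (+ GCD N C⟨ N ⟩) (Pw N C⟨ N ⟩ p) ⟨
  ℤ.∣ + GCD N C⟨ N ⟩ ℤ.* Pw N C⟨ N ⟩ p ∣
    ≡⟨ cong ℤ.∣_∣ (GCD*Pw-*^ M r pr p∤M) ⟩
  ℤ.∣ (-1ℤ ℤ.- (odd r ℤ.* -1ℤ ℤ.+ odd (suc r) ℤ.* + p)) ℤ.* φ M ∣
    ≡⟨ cong₂ (λ x y → ℤ.∣ (-1ℤ ℤ.- (x ℤ.* -1ℤ ℤ.+ y ℤ.* + p)) ℤ.* φ M ∣)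
         (odd≡0 (2∤1+n⇒2∣n 2∤1+r)) (odd≡1 2∤1+r) ⟩
  ℤ.∣ (-1ℤ ℤ.- (0ℤ ℤ.+ 1ℤ ℤ.* + p)) ℤ.* φ M ∣
    ≡⟨ cong (λ z → ℤ.∣ z ℤ.* φ M ∣) (simplify (+ p)) ⟩
  ℤ.∣ ℤ.- + suc p ℤ.* φ M ∣
    ≡⟨ ℤ.abs-* (ℤ.- + suc p) (φ M) ⟩
  suc p * ℤ.∣ φ M ∣
    ≡⟨ cong (suc p *_) (∣φ∣ M) ⟩
  suc p * totients (primeDivisors M) ∎
  where
  open ≡-Reasoning
  N = M * p ^ suc r
  simplify : ∀ x → -1ℤ ℤ.- (0ℤ ℤ.+ 1ℤ ℤ.* x) ≡ ℤ.- (1ℤ ℤ.+ x)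
  simplify = ℤ-Ring.solve-∀

-- Here the odd exponents 1 and r, counted by `U` and `W`, contribute the same -1 and cancel. This
-- gives GCD times Pw equal to zero; the GCD is non-zero because an exponent of at least 2 makes it
-- divide p.
Pw-evenExponent : ∀ {p} M r .{{_ : NonZero M}} → Prime p → p ∤ M → 2 ∣ suc r →
  let N = M * p ^ suc r in Pw N C⟨ N ⟩ p ≡ 0ℤ
Pw-evenExponent {p} M zero    pr p∤M 2∣1 = contradiction (∣1⇒≡1 2∣1) λ ()
Pw-evenExponent {p} M (suc r) pr p∤M 2∣2+r =
  [ (λ G≡0 → contradiction (subst (_∣ p) (ℤ.+-injective G≡0) GCD∣p) 0∤p) , id ]′ (ℤ.i*j≡0⇒i≡0∨j≡0 (+ GCD N C⟨ N ⟩) product≡0)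
  where
  open ≡-Reasoning
  N = M * p ^ (2+ r)
  1<N : 1 < N
  1<N = <-≤-trans (≤-<-trans (s≤s z≤n) (n<p^n (prime>1 pr) (2+ r))) (m≤n*m (p ^ (2+ r)) M)
  GCD∣p : GCD N C⟨ N ⟩ ∣ p
  GCD∣p = commonDivisor-*^2+ M r pr p∤M (∣GCD⁻ 1<N ∣-refl)
  0∤p : 0 ∤ p
  0∤p 0∣p = contradiction (subst Prime (0∣⇒≡0 0∣p) pr) ¬prime[0]
  product≡0 : + GCD N C⟨ N ⟩ ℤ.* Pw N C⟨ N ⟩ p ≡ 0ℤ
  product≡0 = begin
    + GCD N C⟨ N ⟩ ℤ.* Pw N C⟨ N ⟩ p
      ≡⟨ GCD*Pw-*^ M (suc r) pr p∤M ⟩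
    (-1ℤ ℤ.- (odd (suc r) ℤ.* -1ℤ ℤ.+ odd (2+ r) ℤ.* + p)) ℤ.* φ M
      ≡⟨ cong₂ (λ x y → (-1ℤ ℤ.- (x ℤ.* -1ℤ ℤ.+ y ℤ.* + p)) ℤ.* φ M)
           (odd≡1 (λ 2∣1+r → 2∣n⇒2∤1+n 2∣1+r 2∣2+r)) (odd≡0 2∣2+r) ⟩
    0ℤ ∎

Pw-∤ : ∀ {p} N .{{_ : NonZero N}} → Prime p → p ∤ N → Pw N C⟨ N ⟩ p ≡ 0ℤ
Pw-∤ {p} N pr p∤N = trans (Pw≡∑ N C⟨ N ⟩ p) (∑-zero (divisors N) λ {δ} δ∈ →
  cong (λ e → odd e ℤ.* 𝕍 N C⟨ N ⟩ δ) (val≡0 (∈-divisors⁻ N δ∈)))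
  where
  val≡0 : ∀ {δ} → δ ∣ N → val p δ ≡ 0
  val≡0 {δ} δ∣N = val≡ {{∣⇒nonZero δ∣N}} (prime>1 pr) (1∣ δ)
    λ p^1∣δ → p∤N (∣-trans (∣-trans (m∣m*n 1) p^1∣δ) δ∣N)

-- The parity of Pw_p(C_N)

-- Applied with p = 2 and `k` the odd value of Pw: every factor 2 of the product then lies in `g`.
^∣*⇒^∣ : ∀ {p k} j g → Prime p → p ∤ k → p ^ j ∣ k * g → p ^ j ∣ g
^∣*⇒^∣         zero    g pr p∤k _ = 1∣ g
^∣*⇒^∣ {p} {k} (suc j) g pr p∤k p^1+j∣ =
  [ (λ p∣k → contradiction p∣k p∤k) , cancel ]′ (euclidsLemma k g pr (∣-trans (m∣m*n (p ^ j)) p^1+j∣))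
  where
  cancel : p ∣ g → p ^ suc j ∣ g
  cancel (divides g′ refl) = subst (_∣ g′ * p) (*-comm (p ^ j) p)
    (*-monoˡ-∣ p (^∣*⇒^∣ j g′ pr p∤k (*-cancelʳ-∣ p {{prime⇒nonZero pr}}
      (subst₂ _∣_ (*-comm p (p ^ j)) (sym (*-assoc k g′ p)) p^1+j∣))))

oddPrime : ∀ {q} → Prime q → q ≢ 2 → 2 ∤ q
oddPrime qr q≢2 2∣q = q≢2 (sym (prime∣prime⇒≡ prime[2] qr 2∣q))

2∤*⇒ : ∀ {m n} → 2 ∤ m → 2 ∤ n → 2 ∤ m * n
2∤*⇒ {m} {n} 2∤m 2∤n 2∣mn = [ 2∤m , 2∤n ]′ (euclidsLemma m n prime[2] 2∣mn)

2∣pred : ∀ {q} → 2 ∤ q → 2 ∣ pred q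
2∣pred {zero}  2∤0 = contradiction (2 ∣0) 2∤0
2∣pred {suc q} 2∤  = 2∤1+n⇒2∣n 2∤

2∣totients : ∀ {q ps} → q ∈ ps → 2 ∤ q → 2 ∣ totients ps
2∣totients {q} q∈ 2∤q = ∣-trans (2∣pred 2∤q) (∈⇒∣product (∈-map⁺ pred q∈))

totients-↭ : xs ↭ ys → totients xs ≡ totients ys
totients-↭ xs↭ys = product-↭ (map⁺ pred xs↭ys)

p²-1≡ : ∀ p .{{_ : NonZero p}} → + (p ^ 2) ℤ.- 1ℤ ≡ + (suc p * pred p)
p²-1≡ p@(suc n) = begin
  + (p ^ 2) ℤ.- 1ℤ          ≡⟨ cong (λ m → + (p * m) ℤ.- 1ℤ) (*-identityʳ p) ⟩
  + (p * p) ℤ.- 1ℤ          ≡⟨ cong (λ z → z ℤ.- 1ℤ) (ℤ.pos-* p p) ⟩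
  + p ℤ.* + p ℤ.- 1ℤ        ≡⟨ factor (+ n) ⟩
  (+ 2 ℤ.+ + n) ℤ.* + n     ≡⟨ ℤ.pos-* (suc p) n ⟨
  + (suc p * n)             ∎
  where
  open ≡-Reasoning
  factor : ∀ n → (1ℤ ℤ.+ n) ℤ.* (1ℤ ℤ.+ n) ℤ.- 1ℤ ≡ (+ 2 ℤ.+ n) ℤ.* n
  factor = ℤ-Ring.solve-∀

conditions⇒∣p²-1 : ∀ {c N p} → SquarefreeConditions c N → p ∈ primeDivisors N → c ∣ suc p * pred p
conditions⇒∣p²-1 {c} {N} {p} (_ , c∣p²-1) p∈ = ℤ.∣⇒∣ᵤ (subst (+ c ℤ.∣_)
  (p²-1≡ p {{prime⇒nonZero (proj₁ (∈-primeDivisors⁻ N p∈))}}) (c∣p²-1 p∈))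

-- An odd Pw_p forces an exceptional level

ω-* : ∀ {p} M r .{{_ : NonZero M}} → Prime p → p ∤ M → ω (M * p ^ suc r) ≡ suc (ω M)
ω-* M r pr p∤M = ↭-length (primeDivisors-*^ r pr p∤M)

∈-primeDivisors-*^ : ∀ {p q} M r .{{_ : NonZero M}} → Prime p → p ∤ M →
  q ∈ p ∷ primeDivisors M → q ∈ primeDivisors (M * p ^ suc r)
∈-primeDivisors-*^ M r pr p∤M = ∈-resp-↭ (↭-sym (primeDivisors-*^ r pr p∤M))

-- With exponent at least 3, `c` is 1. With exponent 1, either N is squarefree and `c` divides 2² -
-- 1 = 3, or q² divides N for some q, which is odd since 4 does not divide N, and `c` divides q.
commonDivisor-2*odd : ∀ {c} M r .{{_ : NonZero M}} → 2 ∤ M → 2 ∤ suc r → CommonDivisor c (M * 2 ^ suc r) → 2 ∤ c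
commonDivisor-2*odd     M (suc zero)    2∤M 2∤2 c∣D 2∣c = 2∤2 ∣-refl
commonDivisor-2*odd {c} M (suc (suc r)) 2∤M _ c∣D 2∣c =
  contradiction (∣1⇒≡1 (∣-trans 2∣c (commonDivisor-*^3+ M r prime[2] 2∤M c∣D))) λ ()
commonDivisor-2*odd {c} M zero          2∤M _ c∣D 2∣c with squarefree? (M * 2 ^ 1) {{m*n≢0 M 2}}
... | yes sf = contradiction (∣-trans 2∣c c∣3) (2∣n⇒2∤1+n {2} ∣-refl)
  where
  instance _ = m*n≢0 M 2
  c∣3 : c ∣ 3
  c∣3 = conditions⇒∣p²-1 {c} {M * 2 ^ 1} {2}
    (commonDivisor⇒conditions (M * 2 ^ 1) (squarefree⇒exponents1 (M * 2 ^ 1) sf) c∣D)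
    (∈-primeDivisors-*^ M 0 prime[2] 2∤M (here refl))
... | no ¬sf with ¬squarefree⇒ (M * 2 ^ 1) {{m*n≢0 M 2}} ¬sf
...   | q , qr , q²∣N = contradiction
  (subst (λ q → q ^ 2 ∣ M * 2 ^ 1) (sym (prime∣prime⇒≡ prime[2] qr 2∣q)) q²∣N)
  λ 4∣N → case ^∣⇒≤exponent {j = 2} 1 prime[2] 2∤M 4∣N of λ { (s≤s ()) }
  where
  instance _ = m*n≢0 M 2
  2∣q : 2 ∣ q
  2∣q = ∣-trans 2∣c (commonDivisor-square (M * 2 ^ 1) qr q²∣N c∣D)

-- From here on `k` stands for the absolute value of Pw_p and `g` for the GCD. For p = 2 both `k`
-- and `g` are odd, so no factor q - 1 can occur and `M` is 1.
odd-Pw₂ : ∀ {k g} M r .{{_ : NonZero M}} → 2 ∤ M → 2 ∤ suc r → CommonDivisor g (M * 2 ^ suc r) →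
  k * g ≡ 3 * totients (primeDivisors M) → 2 ∤ k → IsOddPowerOf2 (M * 2 ^ suc r)
odd-Pw₂ 1 r 2∤M 2∤1+r _ _ _ = suc r , 2∤1+r , *-identityˡ (2 ^ suc r)
odd-Pw₂ {k} {g} M@(2+ _) r 2∤M 2∤1+r g∣D kg≡ 2∤k with ∃-primeDivisor M (s≤s (s≤s z≤n))
... | q , qr , q∣M = contradiction 2∣kg (2∤*⇒ 2∤k (commonDivisor-2*odd M r 2∤M 2∤1+r g∣D))
  where
  2∣kg : 2 ∣ k * g
  2∣kg = subst (2 ∣_) (sym kg≡) (∣n⇒∣m*n 3 (2∣totients (∈-primeDivisors⁺ qr q∣M) λ 2∣q → 2∤M (∣-trans 2∣q q∣M)))

1+p≡2k⇒p%4≡1 : ∀ {p k} → k * 2 ≡ suc p → 2 ∤ k → p % 4 ≡ 1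
1+p≡2k⇒p%4≡1 {p} {zero}  ()
1+p≡2k⇒p%4≡1 {p} {suc k} eq 2∤1+k with 2∤1+n⇒2∣n 2∤1+k
... | divides j refl = trans (cong (_% 4) p≡) ([m+kn]%n≡m%n 1 j 4)
  where
  p≡ : p ≡ 1 + j * 4
  p≡ = suc-injective (trans (sym eq) (cong 2+ (*-assoc j 2 2)))

-- An even `g` dividing q forces q = g = 2, so 4 divides `M` and 2 k = (p + 1) ∏ (q - 1). As p + 1
-- is even and `k` odd, `M` has no odd prime factor; as `g` is not 1, 8 does not divide N. What
-- remains is 2 k = p + 1.
odd-Pw-square : ∀ {p q k g} M .{{_ : NonZero M}} → Prime p → p ∤ M → 2 ∤ p → CommonDivisor g (M * p ^ 1) →
  k * g ≡ suc p * totients (primeDivisors M) → 2 ∤ k → 2 ∣ g → Prime q → q ^ 2 ∣ M * p ^ 1 → Is4Prime1Mod4 (M * p ^ 1)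
odd-Pw-square {p} {q} {k} {g} M pr p∤M 2∤p g∣D kg≡ 2∤k 2∣g qr q²∣N = helper M refl (squarePart prime[2] 4∣M)
  where
  instance
    _ = m^n≢0 p 1 {{prime⇒nonZero pr}}
    N≢0 : NonZero (M * p ^ 1)
    N≢0 = m*n≢0 M (p ^ 1)
  q≡2 : q ≡ 2
  q≡2 = sym (prime∣prime⇒≡ prime[2] qr (∣-trans 2∣g (commonDivisor-square (M * p ^ 1) qr q²∣N g∣D)))
  4∣N : 2 ^ 2 ∣ M * p ^ 1
  4∣N = subst (λ q → q ^ 2 ∣ M * p ^ 1) q≡2 q²∣N
  p∤2 : p ∤ 2
  p∤2 p∣2 = 2∤p (∣-reflexive (sym (prime∣prime⇒≡ pr prime[2] p∣2)))
  4∣M : 2 ^ 2 ∣ M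
  4∣M = coprime⇒∣-cancel-^ 1 pr (p∤2 ∘ prime∣^⇒∣ 2 2 pr) 4∣N
  g≡2 : g ≡ 2
  g≡2 = ∣-antisym (commonDivisor-square (M * p ^ 1) prime[2] 4∣N g∣D) 2∣g
  -- Both p + 1 and q - 1 are even, so 4 divides 2 k.
  2∤L⇒ : ∀ {q} → Prime q → q ∣ M → 2 ∤ q → 2 ∣ k
  2∤L⇒ {q} qr q∣M 2∤q = *-cancelʳ-∣ 2 (subst (4 ∣_) (trans (sym kg≡) (cong (k *_) g≡2))
    (*-pres-∣ {2} {suc p} {2} (2∤n⇒2∣1+n 2∤p) (2∣totients (∈-primeDivisors⁺ qr q∣M) 2∤q)))
  helper : ∀ M′ → M ≡ M′ → SquarePart 2 M′ → Is4Prime1Mod4 (M * p ^ 1)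
  helper _ M≡ (part² 1 zero 2∤L) = p , pr ,
    1+p≡2k⇒p%4≡1 {p} {k} (trans (cong (k *_) (sym g≡2)) (trans kg≡
      (trans (cong (λ M → suc p * totients (primeDivisors M)) M≡) (*-identityʳ (suc p))))) 2∤k ,
    trans (cong (_* p ^ 1) M≡) (cong (4 *_) (*-identityʳ p))
  helper _ M≡ (part² L@(2+ _) zero 2∤L) with ∃-primeDivisor L (s≤s (s≤s z≤n))
  ... | q , qr , q∣L = contradiction
    (2∤L⇒ qr (subst (q ∣_) (sym M≡) (∣m⇒∣m*n (2 ^ 2) q∣L)) (λ 2∣q → 2∤L (∣-trans 2∣q q∣L))) 2∤k
  helper _ M≡ (part² L (suc r) 2∤L) = contradiction
    (∣1⇒≡1 (∣-trans 2∣g (commonDivisor-cube (M * p ^ 1) prime[2] 8∣N g∣D))) λ ()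
    where
    8∣N : 2 ^ 3 ∣ M * p ^ 1
    8∣N = ∣m⇒∣m*n (p ^ 1) (subst (2 ^ 3 ∣_) (sym M≡) (∣n⇒∣m*n L (^-monoʳ-∣ 2 {3} {3 + r} (s≤s (s≤s (s≤s z≤n))))))

-- Here g contains at least two more factors 2 than x, which must come from x′.
quarter : ∀ {k g x z x′} .{{_ : NonZero x}} → 2 ∤ k → k * g ≡ x * z → 4 ∣ z → g ∣ x * x′ → 4 ∣ x′
quarter {k} {g} {x} {z} {x′} 2∤k kg≡xz 4∣z g∣xx′ with split {2} (s≤s (s≤s z≤n)) x
... | u , v , refl , 2∤u = ^∣*⇒^∣ 2 x′ prime[2] 2∤u (*-cancelˡ-∣ (2 ^ v) {{m^n≢0 2 v}}
  (subst₂ _∣_ (^-distribˡ-+-* 2 v 2) rearrange (∣-trans 2^v+2∣g g∣xx′)))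
  where
  2^v+2∣g : 2 ^ (v + 2) ∣ g
  2^v+2∣g = ^∣*⇒^∣ (v + 2) g prime[2] 2∤k (subst₂ _∣_ (sym (^-distribˡ-+-* 2 v 2)) (sym kg≡xz)
    (*-pres-∣ (n∣m*n u) 4∣z))
  rearrange : u * 2 ^ v * x′ ≡ 2 ^ v * (u * x′)
  rearrange = trans (cong (_* x′) (*-comm u (2 ^ v))) (*-assoc (2 ^ v) u x′)

∈⇒↭∷ : ∀ {x : A} {xs} → x ∈ xs → ∃[ ys ] xs ↭ x ∷ ys
∈⇒↭∷ {x = x} x∈xs with ∈-∃++ x∈xs
... | ys , zs , refl = ys ++ zs , shift x ys zs

2∤∈-primeDivisors : ∀ {M q} → 2 ∤ M → q ∈ primeDivisors M → 2 ∤ q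
2∤∈-primeDivisors {M} 2∤M q∈ 2∣q = 2∤M (∣-trans 2∣q (proj₂ (∈-primeDivisors⁻ M q∈)))

-- With at least three prime factors, p ≡ 1 and q ≡ -1 (mod 4) for the other primes q,
-- which contradicts N ≡ (-1) ^ ω N.
odd-Pw-ω≥3 : ∀ {p k g} M .{{_ : NonZero M}} → Prime p → p ∤ M → 2 ∤ p → 2 ∤ M → AllExponents1 M →
  SquarefreeConditions g (M * p ^ 1) → k * g ≡ suc p * totients (primeDivisors M) → 2 ∤ k →
  ¬ (2 ≤ ω M)
odd-Pw-ω≥3 {p} {k} {g} M pr p∤M 2∤p 2∤M ones cond@(g∣N-ε , _) kg≡ 2∤k 2≤ω = contradiction 4∣2 4∤2
  where
  T = totients (primeDivisors M)
  ε = -1ℤ ℤ.^ ω M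
  instance
    p≢0 : NonZero p
    p≢0 = prime⇒nonZero pr

  -- After removing q - 1 at least one further odd prime remains, so the cofactor is even.
  others : ∀ {q} → q ∈ primeDivisors M → ∃[ z ] T ≡ pred q * z × 2 ∣ z
  others {q} q∈ with ∈⇒↭∷ q∈
  ... | []     , PD↭ = contradiction (subst (2 ≤_) (↭-length PD↭) 2≤ω) λ { (s≤s ()) }
  ... | r ∷ rs , PD↭ = totients (r ∷ rs) , totients-↭ PD↭ ,
    2∣totients {ps = r ∷ rs} (here refl) (2∤∈-primeDivisors 2∤M (∈-resp-↭ (↭-sym PD↭) (there (here refl))))

  4∣T : 4 ∣ T
  4∣T = go (primeDivisors M) (2∤∈-primeDivisors 2∤M) 2≤ω
    where
    go : ∀ ps → (∀ {q} → q ∈ ps → 2 ∤ q) → 2 ≤ length ps → 4 ∣ totients ps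
    go (q ∷ [])     _   (s≤s ())
    go (q ∷ r ∷ ps) 2∤ _ = *-pres-∣ {2} {pred q} {2} (2∣pred (2∤ (here refl)))
      (2∣totients {ps = r ∷ ps} (here refl) (2∤ (there (here refl))))

  4∣p-1 : 4 ∣ pred p
  4∣p-1 = quarter {k} {g} {suc p} {T} 2∤k kg≡ 4∣T
    (conditions⇒∣p²-1 {g} {M * p ^ 1} cond (∈-primeDivisors-*^ M 0 pr p∤M (here refl)))

  4∣q+1 : ∀ {q} → q ∈ primeDivisors M → 4 ∣ suc q
  4∣q+1 {q} q∈ with others q∈
  ... | z , T≡ , 2∣z = quarter {k} {g} {pred q} {suc p * z} {{pred≢0 qr}} 2∤k kg≡′
    (*-pres-∣ {2} {suc p} {2} (2∤n⇒2∣1+n 2∤p) 2∣z)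
    (subst (g ∣_) (*-comm (suc q) (pred q))
      (conditions⇒∣p²-1 {g} {M * p ^ 1} cond (∈-primeDivisors-*^ M 0 pr p∤M (there q∈))))
    where
    open ≡-Reasoning
    qr = proj₁ (∈-primeDivisors⁻ M q∈)
    kg≡′ : k * g ≡ pred q * (suc p * z)
    kg≡′ = begin
      k * g                  ≡⟨ kg≡ ⟩
      suc p * T              ≡⟨ cong (suc p *_) T≡ ⟩
      suc p * (pred q * z)   ≡⟨ *-assoc (suc p) (pred q) z ⟨
      suc p * pred q * z     ≡⟨ cong (_* z) (*-comm (suc p) (pred q)) ⟩
      pred q * suc p * z     ≡⟨ *-assoc (pred q) (suc p) z ⟩
      pred q * (suc p * z)   ∎

  4∣g : 4 ∣ g
  4∣g = ^∣*⇒^∣ 2 g prime[2] 2∤k (subst (4 ∣_) (sym kg≡) (∣n⇒∣m*n (suc p) 4∣T))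

  4∣M-ε : + 4 ℤ.∣ + M ℤ.- ε
  4∣M-ε = subst₂ (λ x y → + 4 ℤ.∣ x ℤ.- y) (∏-primeDivisors M ones) (∏-const -1ℤ (primeDivisors M))
    (∏-cong-mod (primeDivisors M) λ {q} q∈ → subst (+ 4 ℤ.∣_) (ℤ.+-comm 1ℤ (+ q)) (ℤ.∣ᵤ⇒∣ (4∣q+1 q∈)))

  -- The sign is opposite to that in `4∣M-ε` because N has one prime factor more than `M`.
  4∣Mp+ε : + 4 ℤ.∣ + M ℤ.* + p ℤ.+ ε
  4∣Mp+ε = subst (+ 4 ℤ.∣_) eq (ℤ.∣-trans (ℤ.∣ᵤ⇒∣ 4∣g) g∣N-ε)
    where
    open ≡-Reasoning
    eq : + (M * p ^ 1) ℤ.- -1ℤ ℤ.^ ω (M * p ^ 1) ≡ + M ℤ.* + p ℤ.+ ε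
    eq = begin
      + (M * p ^ 1) ℤ.- -1ℤ ℤ.^ ω (M * p ^ 1)
        ≡⟨ cong₂ (λ x y → + (M * x) ℤ.- -1ℤ ℤ.^ y) (^-identityʳ p) (ω-* M 0 pr p∤M) ⟩
      + (M * p) ℤ.- -1ℤ ℤ.* ε
        ≡⟨ cong₂ (λ x y → x ℤ.- y) (ℤ.pos-* M p) (ℤ.-1*i≡-i ε) ⟩
      + M ℤ.* + p ℤ.- ℤ.- ε
        ≡⟨ cong (λ z → + M ℤ.* + p ℤ.+ z) (ℤ.neg-involutive ε) ⟩
      + M ℤ.* + p ℤ.+ ε ∎

  -- Modulo 4, p ≡ 1 and M ≡ ε give M p + ε ≡ 2 ε, which must vanish.
  4∣2ε : + 4 ℤ.∣ + 2 ℤ.* ε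
  4∣2ε = subst (+ 4 ℤ.∣_) combination
    (ℤ.∣m∣n⇒∣m-n (ℤ.∣m∣n⇒∣m-n 4∣Mp+ε (ℤ.∣m⇒∣m*n (+ p) 4∣M-ε)) (ℤ.∣n⇒∣m*n ε (ℤ.∣ᵤ⇒∣ {i = + pred p} 4∣p-1)))
    where
    combine : ∀ m ε p → (m ℤ.* (1ℤ ℤ.+ p) ℤ.+ ε) ℤ.- (m ℤ.- ε) ℤ.* (1ℤ ℤ.+ p) ℤ.- ε ℤ.* p ≡ + 2 ℤ.* ε
    combine = ℤ-Ring.solve-∀
    combination : (+ M ℤ.* + p ℤ.+ ε) ℤ.- (+ M ℤ.- ε) ℤ.* + p ℤ.- ε ℤ.* + pred p ≡ + 2 ℤ.* ε
    combination = subst (λ n → (+ M ℤ.* + n ℤ.+ ε) ℤ.- (+ M ℤ.- ε) ℤ.* + n ℤ.- ε ℤ.* + pred p ≡ + 2 ℤ.* ε)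
      (suc-pred p) (combine (+ M) ε (+ pred p))

  4∣2 : 4 ∣ 2
  4∣2 = ℤ.∣⇒∣ᵤ (∣-cancel-unit {+ 4} (+ 2) ε (∣-1^n∣≡1 (ω M)) 4∣2ε)

  4∤2 : 4 ∤ 2
  4∤2 = >⇒∤ (s≤s (s≤s (s≤s z≤n)))

-- 2-adic valuations and products of two primes

2^val∣ : ∀ n .{{_ : NonZero n}} → 2 ^ val 2 n ∣ n
2^val∣ n with split {2} (s≤s (s≤s z≤n)) n
... | m , k , refl , 2∤m = subst (λ j → 2 ^ j ∣ m * 2 ^ k)
  (sym (val-*^ k {{m*n≢0⇒m≢0 m}} (s≤s (s≤s z≤n)) 2∤m)) (n∣m*n m)

2^1+val∤ : ∀ n .{{_ : NonZero n}} → 2 ^ suc (val 2 n) ∤ n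
2^1+val∤ n with split {2} (s≤s (s≤s z≤n)) n
... | m , k , refl , 2∤m = λ h → 1+n≰n (^∣⇒≤exponent {j = suc k} k prime[2] 2∤m
  (subst (λ j → 2 ^ suc j ∣ m * 2 ^ k) (val-*^ k {{m*n≢0⇒m≢0 m}} (s≤s (s≤s z≤n)) 2∤m) h))

val₂-close : ∀ x y .{{_ : NonZero x}} .{{_ : NonZero y}} →
  + (2 ^ suc (val 2 x)) ℤ.∣ + y ℤ.- + x → val 2 y ≡ val 2 x
val₂-close x y 2^∣y-x = val≡ (s≤s (s≤s z≤n)) (ℤ.∣⇒∣ᵤ 2^v∣y)
  λ 2^1+v∣y → 2^1+val∤ x (ℤ.∣⇒∣ᵤ (subst (+ (2 ^ suc (val 2 x)) ℤ.∣_) (cancelʸ (+ y) (+ x))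
    (ℤ.∣m∣n⇒∣m-n (ℤ.∣ᵤ⇒∣ {i = + y} 2^1+v∣y) 2^∣y-x)))
  where
  cancelˣ : ∀ y x → (y ℤ.- x) ℤ.+ x ≡ y
  cancelˣ = ℤ-Ring.solve-∀
  cancelʸ : ∀ y x → y ℤ.- (y ℤ.- x) ≡ x
  cancelʸ = ℤ-Ring.solve-∀
  2^v∣y : + (2 ^ val 2 x) ℤ.∣ + y
  2^v∣y = subst (+ (2 ^ val 2 x) ℤ.∣_) (cancelˣ (+ y) (+ x))
    (ℤ.∣m∣n⇒∣m+n (ℤ.∣-trans (ℤ.∣ᵤ⇒∣ (^-monoʳ-∣ 2 (n≤1+n (val 2 x)))) 2^∣y-x)
                 (ℤ.∣ᵤ⇒∣ {i = + x} (2^val∣ x)))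

-- Modulo g both p q - 1 and p² - 1 vanish, hence so does q - p. Since v₂(g) = v₂((p + 1)(q - 1)) exceeds
-- both v₂(p + 1) and v₂(q - 1), these valuations do not change when p and q are exchanged.
odd-Pw-ω≡2 : ∀ {p q k g} → Prime p → Prime q → 2 ∤ p → 2 ∤ q →
  + g ℤ.∣ + p ℤ.* + q ℤ.- 1ℤ → g ∣ suc p * pred p → k * g ≡ suc p * pred q → 2 ∤ k →
  val 2 (p ∸ 1) ≡ val 2 (q ∸ 1) × val 2 (p + 1) ≡ val 2 (q + 1)
odd-Pw-ω≡2 {p} {q} {k} {g} pr qr 2∤p 2∤q g∣pq-1 g∣p²-1 kg≡ 2∤k = a≡ , sym b≡
  where
  instance
    p≢0 : NonZero p
    p≢0 = prime⇒nonZero pr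
    q≢0 : NonZero q
    q≢0 = prime⇒nonZero qr
    p-1≢0 : NonZero (pred p)
    p-1≢0 = pred≢0 pr
    q-1≢0 : NonZero (pred q)
    q-1≢0 = pred≢0 qr
    p+1≢0 : NonZero (p + 1)
    p+1≢0 = >-nonZero (m≤n+m 1 p)
    q+1≢0 : NonZero (q + 1)
    q+1≢0 = >-nonZero (m≤n+m 1 q)
  a b : ℕ
  a = val 2 (pred q)
  b = val 2 (p + 1)
  1≤a : 1 ≤ a
  1≤a = ∣⇒1≤val prime[2] (2∣pred 2∤q)
  1≤b : 1 ≤ b
  1≤b = ∣⇒1≤val prime[2] (subst (2 ∣_) (+-comm 1 p) (2∤n⇒2∣1+n 2∤p))
  2^∣g : 2 ^ (b + a) ∣ g
  2^∣g = ^∣*⇒^∣ (b + a) g prime[2] 2∤k (subst₂ _∣_ (sym (^-distribˡ-+-* 2 b a)) (sym kg≡)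
    (*-pres-∣ (subst (2 ^ b ∣_) (+-comm p 1) (2^val∣ (p + 1))) (2^val∣ (pred q))))
  g∣p[q-p] : + g ℤ.∣ + p ℤ.* (+ q ℤ.- + p)
  g∣p[q-p] = subst (+ g ℤ.∣_) (trans (cong (λ z → + p ℤ.* + q ℤ.- 1ℤ ℤ.- z) p²-1≡p*p-1) (simplify (+ p) (+ q)))
    (ℤ.∣m∣n⇒∣m-n g∣pq-1 (ℤ.∣ᵤ⇒∣ {i = + (suc p * pred p)} g∣p²-1))
    where
    p²-1≡p*p-1 : + (suc p * pred p) ≡ + p ℤ.* + p ℤ.- 1ℤ
    p²-1≡p*p-1 = trans (sym (p²-1≡ p)) (cong (λ z → z ℤ.- 1ℤ)
      (trans (cong (λ m → + (p * m)) (*-identityʳ p)) (ℤ.pos-* p p)))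
    simplify : ∀ p q → p ℤ.* q ℤ.- 1ℤ ℤ.- (p ℤ.* p ℤ.- 1ℤ) ≡ p ℤ.* (q ℤ.- p)
    simplify = ℤ-Ring.solve-∀
  -- The factor p is odd, hence invisible to powers of 2.
  2^∣q-p : + (2 ^ (b + a)) ℤ.∣ + q ℤ.- + p
  2^∣q-p = ℤ.∣ᵤ⇒∣ (^∣*⇒^∣ (b + a) ℤ.∣ + q ℤ.- + p ∣ prime[2] 2∤p
    (subst (2 ^ (b + a) ∣_) (ℤ.abs-* (+ p) (+ q ℤ.- + p)) (∣-trans 2^∣g (ℤ.∣⇒∣ᵤ g∣p[q-p]))))
  a≡ : val 2 (pred p) ≡ a
  a≡ = val₂-close (pred q) (pred p) (subst (+ (2 ^ suc a) ℤ.∣_)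
    (trans (shift-by-1 (+ p) (+ q)) (sym (cong₂ ℤ._-_ (pred≡-1 p) (pred≡-1 q))))
    (ℤ.∣m⇒∣-m (ℤ.∣-trans (ℤ.∣ᵤ⇒∣ (^-monoʳ-∣ 2 (+-monoˡ-≤ a 1≤b))) 2^∣q-p)))
    where
    shift-by-1 : ∀ p q → ℤ.- (q ℤ.- p) ≡ (p ℤ.- 1ℤ) ℤ.- (q ℤ.- 1ℤ)
    shift-by-1 = ℤ-Ring.solve-∀
  b≡ : val 2 (q + 1) ≡ b
  b≡ = val₂-close (p + 1) (q + 1) (subst (+ (2 ^ suc b) ℤ.∣_) (shift-by-1 (+ p) (+ q))
    (ℤ.∣-trans (ℤ.∣ᵤ⇒∣ (^-monoʳ-∣ 2 (subst (_≤ b + a) (+-comm b 1) (+-monoʳ-≤ b 1≤a)))) 2^∣q-p))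
    where
    shift-by-1 : ∀ p q → q ℤ.- p ≡ (q ℤ.+ 1ℤ) ℤ.- (p ℤ.+ 1ℤ)
    shift-by-1 = ℤ-Ring.solve-∀

odd-Pw-squarefree : ∀ {p k g} M .{{_ : NonZero M}} → Prime p → p ∤ M → 2 ∤ p → 2 ∤ M → AllExponents1 M →
  SquarefreeConditions g (M * p ^ 1) → k * g ≡ suc p * totients (primeDivisors M) → 2 ∤ k →
  𝔥Is2 (M * p ^ 1)
odd-Pw-squarefree {p} {k} {g} M pr p∤M 2∤p 2∤M ones cond@(g∣N-ε , _) kg≡ 2∤k = go (primeDivisors M) refl
  where
  open ≡-Reasoning
  go : ∀ ps → primeDivisors M ≡ ps → 𝔥Is2 (M * p ^ 1)
  go []       PD≡ = inj₁ (subst Prime (sym N≡p) pr)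
    where
    M≡1 : M ≡ 1
    M≡1 = ℤ.+-injective (trans (sym (∏-primeDivisors M ones)) (cong (λ ps → ∏ ps (λ q → + q)) PD≡))
    N≡p : M * p ^ 1 ≡ p
    N≡p = trans (cong₂ _*_ M≡1 (^-identityʳ p)) (*-identityˡ p)
  go (q ∷ []) PD≡ = inj₂ (inj₂ (inj₁ (p , q , pr , qr , p≢q , 2∤p , 2∤q , N≡pq ,
    odd-Pw-ω≡2 {p} {q} {k} {g} pr qr 2∤p 2∤q g∣pq-1
      (conditions⇒∣p²-1 {g} {M * p ^ 1} cond (∈-primeDivisors-*^ M 0 pr p∤M (here refl)))
      (trans kg≡ (cong (suc p *_) (trans (cong totients PD≡) (*-identityʳ (pred q))))) 2∤k)))
    where
    q∈ : q ∈ primeDivisors M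
    q∈ = subst (q ∈_) (sym PD≡) (here refl)
    qr : Prime q
    qr = proj₁ (∈-primeDivisors⁻ M q∈)
    2∤q : 2 ∤ q
    2∤q = 2∤∈-primeDivisors 2∤M q∈
    p≢q : p ≢ q
    p≢q refl = p∤M (proj₂ (∈-primeDivisors⁻ M q∈))
    M≡q : M ≡ q
    M≡q = ℤ.+-injective (begin
      + M                              ≡⟨ ∏-primeDivisors M ones ⟨
      ∏ (primeDivisors M) (λ q → + q)  ≡⟨ cong (λ ps → ∏ ps (λ q → + q)) PD≡ ⟩
      + q ℤ.* 1ℤ                       ≡⟨ ℤ.*-identityʳ (+ q) ⟩
      + q                              ∎)
    N≡pq : M * p ^ 1 ≡ p * q
    N≡pq = trans (cong₂ _*_ M≡q (^-identityʳ p)) (*-comm q p)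
    g∣pq-1 : + g ℤ.∣ + p ℤ.* + q ℤ.- 1ℤ
    g∣pq-1 = subst (+ g ℤ.∣_) (cong₂ (λ x t → x ℤ.- -1ℤ ℤ.^ t)
      (trans (cong +_ N≡pq) (ℤ.pos-* p q))
      (trans (ω-* M 0 pr p∤M) (cong (suc ∘ length) PD≡))) g∣N-ε
  go (q ∷ r ∷ ps) PD≡ = contradiction
    (subst (2 ≤_) (sym (cong length PD≡)) (s≤s (s≤s z≤n)))
    (odd-Pw-ω≥3 {p} {k} {g} M pr p∤M 2∤p 2∤M ones cond kg≡ 2∤k)

-- For odd p the factor p + 1 makes `g` even. An exponent of at least 3 would make `g` equal to 1,
-- so the exponent of p is 1, and the cases are split by whether N is squarefree.
odd-Pw⇒𝔥Is2 : ∀ {p k g} M r .{{_ : NonZero M}} → Prime p → p ∤ M → 2 ∤ suc r → CommonDivisor g (M * p ^ suc r) →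
  k * g ≡ suc p * totients (primeDivisors M) → 2 ∤ k → 𝔥Is2 (M * p ^ suc r)
odd-Pw⇒𝔥Is2 {p} {k} {g} M r pr p∤M 2∤1+r g∣D kg≡ 2∤k with p ≟ 2
... | yes refl = inj₂ (inj₁ (odd-Pw₂ {k} M r p∤M 2∤1+r g∣D kg≡ 2∤k))
... | no  p≢2  = go r 2∤1+r g∣D
  where
  instance
    _ = m^n≢0 p 1 {{prime⇒nonZero pr}}
    N≢0 : NonZero (M * p ^ 1)
    N≢0 = m*n≢0 M (p ^ 1)
  2∤p : 2 ∤ p
  2∤p = oddPrime pr p≢2
  2∣g : 2 ∣ g
  2∣g = ^∣*⇒^∣ 1 g prime[2] 2∤k (subst (2 ∣_) (sym kg≡) (∣m⇒∣m*n (totients (primeDivisors M)) (2∤n⇒2∣1+n 2∤p)))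
  go : ∀ r → 2 ∤ suc r → CommonDivisor g (M * p ^ suc r) → 𝔥Is2 (M * p ^ suc r)
  go (suc zero)    2∤2 g∣D = contradiction ∣-refl 2∤2
  go (suc (suc r)) _   g∣D = contradiction (∣1⇒≡1 (∣-trans 2∣g (commonDivisor-*^3+ M r pr p∤M g∣D))) λ ()
  go zero          _   g∣D with squarefree? (M * p ^ 1)
  ... | no ¬sf = let q , qr , q²∣N = ¬squarefree⇒ (M * p ^ 1) ¬sf in
    inj₂ (inj₂ (inj₂ (odd-Pw-square {p} {q} {k} {g} M pr p∤M 2∤p g∣D kg≡ 2∤k 2∣g qr q²∣N)))
  ... | yes sf = odd-Pw-squarefree {p} {k} {g} M pr p∤M 2∤p 2∤M (exponents1-* M 0 pr p∤M ones) cond kg≡ 2∤k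
    where
    ones : AllExponents1 (M * p ^ 1)
    ones = squarefree⇒exponents1 (M * p ^ 1) sf
    cond : SquarefreeConditions g (M * p ^ 1)
    cond = commonDivisor⇒conditions (M * p ^ 1) ones g∣D
    -- If 2 were among the primes, the even number `g` would divide 2² - 1.
    2∤M : 2 ∤ M
    2∤M 2∣M = contradiction (∣-trans 2∣g (conditions⇒∣p²-1 {g} {M * p ^ 1} {2} cond
      (∈-primeDivisors-*^ M 0 pr p∤M (there (∈-primeDivisors⁺ prime[2] 2∣M))))) (2∣n⇒2∤1+n {2} ∣-refl)

¬𝔥Is2⇒allPwEven : ∀ N → 1 < N → ¬ 𝔥Is2 N → AllPwEven N C⟨ N ⟩
¬𝔥Is2⇒allPwEven N 1<N ¬𝔥Is2 p pr with p ∣? N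
... | no  p∤N = subst (λ z → 2 ∣ ℤ.∣ z ∣) (sym (Pw-∤ N {{>-nonZero (<⇒≤ 1<N)}} pr p∤N)) (2 ∣0)
... | yes p∣N = go (primePart {{>-nonZero (<⇒≤ 1<N)}} pr p∣N) 1<N ¬𝔥Is2
  where
  go : ∀ {N} → PrimePart p N → 1 < N → ¬ 𝔥Is2 N → 2 ∣ ℤ.∣ Pw N C⟨ N ⟩ p ∣
  go (part M r p∤M) 1<N ¬𝔥Is2 with 2 ∣? suc r
  ... | yes 2∣1+r = subst (λ z → 2 ∣ ℤ.∣ z ∣) (sym (Pw-evenExponent M r pr p∤M 2∣1+r)) (2 ∣0)
  ... | no  2∤1+r = decidable-stable (2 ∣? ℤ.∣ Pw (M * p ^ suc r) C⟨ M * p ^ suc r ⟩ p ∣) λ 2∤Pw →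
    ¬𝔥Is2 (odd-Pw⇒𝔥Is2 M r pr p∤M 2∤1+r (∣GCD⁻ 1<N ∣-refl) (∣Pw∣*GCD M r pr p∤M 2∤1+r) 2∤Pw)

-- From here on N is written as 1 * p ^ 1, 1 * 2 ^ suc r, 4 * p ^ 1 or 1 * q ^ 1 * p ^ 1, to match the
-- shape M * p ^ suc r for which Pw_p was computed.
2GCD∣ : ∀ {p} M r .{{_ : NonZero M}} → Prime p → p ∤ M → 2 ∤ suc r →
  let N = M * p ^ suc r in
  AllPwEven N C⟨ N ⟩ → 2 * GCD N C⟨ N ⟩ ∣ suc p * totients (primeDivisors M)
2GCD∣ {p} M r pr p∤M 2∤1+r even = subst (2 * GCD N C⟨ N ⟩ ∣_) (∣Pw∣*GCD M r pr p∤M 2∤1+r)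
  (*-monoˡ-∣ (GCD N C⟨ N ⟩) (even p pr))
  where N = M * p ^ suc r

exponents1-∷ : ∀ {p} M .{{_ : NonZero M}} → Prime p → p ∤ M → AllExponents1 M → AllExponents1 (M * p ^ 1)
exponents1-∷ {p} M pr p∤M ones q∈ with ∈-resp-↭ (primeDivisors-*^ 0 pr p∤M) q∈
... | here refl = val-*^ 1 (prime>1 pr) p∤M
... | there q∈M = let qr , q∣M = ∈-primeDivisors⁻ M q∈M in
  trans (val-*^-other M 1 pr qr λ { refl → p∤M q∣M }) (ones q∈M)

∣p²-1⇒ : ∀ {c} p .{{_ : NonZero p}} → c ∣ suc p * pred p → + c ℤ.∣ + (p ^ 2) ℤ.- 1ℤ
∣p²-1⇒ {c} p c∣ = subst (+ c ℤ.∣_) (sym (p²-1≡ p)) (ℤ.∣ᵤ⇒∣ c∣)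

-- For N = p the number N - (-1)^ω is p + 1, which already divides p² - 1.
prime-conditions : ∀ {c p} → Prime p → c ∣ suc p → SquarefreeConditions c (1 * p ^ 1)
prime-conditions {c} {p} pr c∣1+p = subst (+ c ℤ.∣_) N-ε≡ (ℤ.∣ᵤ⇒∣ c∣1+p) , at
  where
  open ≡-Reasoning
  N-ε≡ : + suc p ≡ + (1 * p ^ 1) ℤ.- -1ℤ ℤ.^ ω (1 * p ^ 1)
  N-ε≡ = begin
    + suc p                                  ≡⟨ ℤ.+-comm 1ℤ (+ p) ⟩
    + p ℤ.- -1ℤ ℤ.^ 1                        ≡⟨ cong₂ (λ x t → + x ℤ.- -1ℤ ℤ.^ t)
                                                  (trans (*-identityˡ (p ^ 1)) (^-identityʳ p)) (ω-* 1 0 pr (prime∤1 pr)) ⟨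
    + (1 * p ^ 1) ℤ.- -1ℤ ℤ.^ ω (1 * p ^ 1)  ∎
  at : ∀ {q} → q ∈ primeDivisors (1 * p ^ 1) → + c ℤ.∣ + (q ^ 2) ℤ.- 1ℤ
  at q∈ with ∈-resp-↭ (primeDivisors-*^ 0 pr (prime∤1 pr)) q∈
  ... | here refl = ∣p²-1⇒ p {{prime⇒nonZero pr}} (∣m⇒∣m*n (pred p) c∣1+p)

prime-commonDivisor : ∀ {c p} → Prime p → c ∣ suc p → CommonDivisor c (1 * p ^ 1)
prime-commonDivisor {c} {p} pr c∣1+p = conditions⇒commonDivisor (1 * p ^ 1)
  (exponents1-∷ 1 pr (prime∤1 pr) λ ()) (prime-conditions pr c∣1+p)
  where
  instance
    _ = prime⇒nonZero pr
    _ = m^n≢0 p 1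
    N≢0 : NonZero (1 * p ^ 1)
    N≢0 = m*n≢0 1 (p ^ 1)

prime⇒¬allPwEven : ∀ {p} → Prime p → ¬ AllPwEven (1 * p ^ 1) C⟨ 1 * p ^ 1 ⟩
prime⇒¬allPwEven {p} pr even = contradiction
  (*-cancelʳ-∣ {2} {1} (suc p) (subst (2 * suc p ∣_) (*-comm (suc p) 1)
    (∣-trans (*-monoʳ-∣ 2 (∣GCD⁺ 1<N (prime-commonDivisor pr ∣-refl))) (2GCD∣ 1 0 pr (prime∤1 pr) (prime∤1 prime[2]) even))))
  (prime∤1 prime[2])
  where
  1<N : 1 < 1 * p ^ 1
  1<N = subst (1 <_) (sym (trans (*-identityˡ (p ^ 1)) (^-identityʳ p))) (prime>1 pr)

oddPowerOf2⇒¬allPwEven : ∀ r → 2 ∤ suc r → ¬ AllPwEven (1 * 2 ^ suc r) C⟨ 1 * 2 ^ suc r ⟩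
oddPowerOf2⇒¬allPwEven r 2∤1+r even =
  -- The right-hand side of `2GCD∣` is 3, as there are no other primes.
  contradiction (∣-trans (m∣m*n (GCD N C⟨ N ⟩)) (2GCD∣ 1 r prime[2] (prime∤1 prime[2]) 2∤1+r even)) (2∣n⇒2∤1+n {2} ∣-refl)
  where N = 1 * 2 ^ suc r

-- The GCD is even: p + 1 is even, so 2 is a common divisor at level p, and it persists at level 2²
-- p. An even Pw_p would then give 4 ∣ p + 1. The level is written with 2² last for the GCD and with
-- p last for Pw_p; `N≡` passes between the two.
4*prime⇒¬allPwEven : ∀ {p} → Prime p → p % 4 ≡ 1 → ¬ AllPwEven (4 * p ^ 1) C⟨ 4 * p ^ 1 ⟩
4*prime⇒¬allPwEven {p} pr p%4≡1 even = contradiction 4∣2 (>⇒∤ (s≤s (s≤s (s≤s z≤n))))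
  where
  open ≡-Reasoning
  instance
    _ = prime⇒nonZero pr
    _ = m^n≢0 p 1
    1*p^1≢0 : NonZero (1 * p ^ 1)
    1*p^1≢0 = m*n≢0 1 (p ^ 1)
  N = 4 * p ^ 1
  1+p≡ : suc p ≡ p / 4 * 4 + 2
  1+p≡ = begin
    suc p                    ≡⟨ cong suc (m≡m%n+[m/n]*n p 4) ⟩
    suc (p % 4 + p / 4 * 4)  ≡⟨ cong (λ x → suc (x + p / 4 * 4)) p%4≡1 ⟩
    2 + p / 4 * 4            ≡⟨ +-comm 2 (p / 4 * 4) ⟩
    p / 4 * 4 + 2            ∎
  2∤p : 2 ∤ p
  2∤p 2∣p = 2∣n⇒2∤1+n 2∣p (subst (2 ∣_) (sym 1+p≡) (∣m∣n⇒∣m+n (∣n⇒∣m*n (p / 4) (divides 2 refl)) ∣-refl))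
  p∤4 : p ∤ 4
  p∤4 p∣4 = 2∤p (∣-reflexive (sym (prime∣prime⇒≡ pr prime[2] (prime∣^⇒∣ 2 2 pr p∣4))))
  2∤1*p^1 : 2 ∤ 1 * p ^ 1
  2∤1*p^1 2∣ = 2∤p (subst (2 ∣_) (trans (*-identityˡ (p ^ 1)) (^-identityʳ p)) 2∣)
  N≡ : 1 * p ^ 1 * 2 ^ 2 ≡ N
  N≡ = trans (*-comm (1 * p ^ 1) 4) (cong (4 *_) (*-identityˡ (p ^ 1)))
  1<N : 1 < N
  1<N = <-≤-trans (s≤s (s≤s z≤n)) (m≤m*n 4 (p ^ 1))
  2∣D : CommonDivisor 2 (1 * p ^ 1 * 2 ^ 2)
  2∣D = commonDivisor-*²⁺ (1 * p ^ 1) prime[2] 2∤1*p^1 ∣-refl (prime-commonDivisor pr (2∤n⇒2∣1+n 2∤p))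
  2∣GCD : 2 ∣ GCD N C⟨ N ⟩
  2∣GCD = ∣GCD⁺ 1<N (λ {δ} δ∣N → subst (λ N → + 2 ℤ.∣ D N δ) N≡ (2∣D (subst (δ ∣_) (sym N≡) δ∣N)))
  4∣1+p : 4 ∣ suc p
  4∣1+p = subst (4 ∣_) (*-identityʳ (suc p))
    (∣-trans (*-monoʳ-∣ 2 2∣GCD) (2GCD∣ 4 0 pr p∤4 (prime∤1 prime[2]) even))
  4∣2 : 4 ∣ 2
  4∣2 = ∣m+n∣m⇒∣n (subst (4 ∣_) 1+p≡ 4∣1+p) (n∣m*n (p / 4))

-- After the common power of 2 is taken out, the difference of two odd numbers supplies one more
-- factor 2.
oddParts-close : ∀ x y .{{_ : NonZero x}} .{{_ : NonZero y}} → val 2 x ≡ val 2 y →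
  + (2 ^ suc (val 2 x)) ℤ.∣ + x ℤ.- + y
oddParts-close x y v≡ with split {2} (s≤s (s≤s z≤n)) x | split {2} (s≤s (s≤s z≤n)) y
... | m , j , refl , 2∤m | n , k , refl , 2∤n
  with trans (sym (val-*^ j {{m*n≢0⇒m≢0 m}} (s≤s (s≤s z≤n)) 2∤m)) (trans v≡ (val-*^ k {{m*n≢0⇒m≢0 n}} (s≤s (s≤s z≤n)) 2∤n))
... | refl = subst (λ v → + (2 ^ suc v) ℤ.∣ + (m * 2 ^ j) ℤ.- + (n * 2 ^ j))
  (sym (val-*^ j {{m*n≢0⇒m≢0 m}} (s≤s (s≤s z≤n)) 2∤m))
  (subst₂ ℤ._∣_ (sym (ℤ.pos-* 2 (2 ^ j))) factor (ℤ.*-monoˡ-∣ (+ (2 ^ j)) 2∣m-n))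
  where
  open ≡-Reasoning
  2∣m-n : + 2 ℤ.∣ + m ℤ.- + n
  2∣m-n = subst (+ 2 ℤ.∣_) (shift-by-1 (+ m) (+ n))
    (ℤ.∣m∣n⇒∣m-n (ℤ.∣ᵤ⇒∣ {i = + suc m} (2∤n⇒2∣1+n 2∤m)) (ℤ.∣ᵤ⇒∣ {i = + suc n} (2∤n⇒2∣1+n 2∤n)))
    where
    shift-by-1 : ∀ m n → (1ℤ ℤ.+ m) ℤ.- (1ℤ ℤ.+ n) ≡ m ℤ.- n
    shift-by-1 = ℤ-Ring.solve-∀
  factor : (+ m ℤ.- + n) ℤ.* + (2 ^ j) ≡ + (m * 2 ^ j) ℤ.- + (n * 2 ^ j)
  factor = begin
    (+ m ℤ.- + n) ℤ.* + (2 ^ j)                ≡⟨ distrib (+ m) (+ n) (+ (2 ^ j)) ⟩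
    + m ℤ.* + (2 ^ j) ℤ.- + n ℤ.* + (2 ^ j)    ≡⟨ cong₂ ℤ._-_ (ℤ.pos-* m (2 ^ j)) (ℤ.pos-* n (2 ^ j)) ⟨
    + (m * 2 ^ j) ℤ.- + (n * 2 ^ j)            ∎
    where
    distrib : ∀ x y z → (x ℤ.- y) ℤ.* z ≡ x ℤ.* z ℤ.- y ℤ.* z
    distrib = ℤ-Ring.solve-∀

-- One of v₂(p + 1) and v₂(q - 1) is 1.
balanced⇒2^∣ : ∀ {p q} → Prime p → Prime q → 2 ∤ p → 2 ∤ q →
  val 2 (p ∸ 1) ≡ val 2 (q ∸ 1) → val 2 (p + 1) ≡ val 2 (q + 1) →
  + (2 ^ (val 2 (p + 1) + val 2 (pred q))) ℤ.∣ + p ℤ.- + q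
balanced⇒2^∣ {p} {q} pr qr 2∤p 2∤q a≡ b≡ = helper (b ≤? 1) (a ≤? 1)
  where
  instance
    p≢0 : NonZero p
    p≢0 = prime⇒nonZero pr
    q≢0 : NonZero q
    q≢0 = prime⇒nonZero qr
    p-1≢0 : NonZero (pred p)
    p-1≢0 = pred≢0 pr
    q-1≢0 : NonZero (pred q)
    q-1≢0 = pred≢0 qr
    p+1≢0 : NonZero (p + 1)
    p+1≢0 = >-nonZero (m≤n+m 1 p)
    q+1≢0 : NonZero (q + 1)
    q+1≢0 = >-nonZero (m≤n+m 1 q)
  a b : ℕ
  a = val 2 (pred q)
  b = val 2 (p + 1)
  2^1+a∣ : + (2 ^ suc a) ℤ.∣ + p ℤ.- + q
  2^1+a∣ = subst₂ (λ v z → + (2 ^ suc v) ℤ.∣ z) a≡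
    (trans (cong₂ ℤ._-_ (pred≡-1 p) (pred≡-1 q)) (shift-by-1 (+ p) (+ q)))
    (oddParts-close (pred p) (pred q) a≡)
    where
    shift-by-1 : ∀ m n → (m ℤ.- 1ℤ) ℤ.- (n ℤ.- 1ℤ) ≡ m ℤ.- n
    shift-by-1 = ℤ-Ring.solve-∀
  2^1+b∣ : + (2 ^ suc b) ℤ.∣ + p ℤ.- + q
  2^1+b∣ = subst (+ (2 ^ suc b) ℤ.∣_) (shift-by-1 (+ p) (+ q)) (oddParts-close (p + 1) (q + 1) b≡)
    where
    shift-by-1 : ∀ m n → (m ℤ.+ 1ℤ) ℤ.- (n ℤ.+ 1ℤ) ≡ m ℤ.- n
    shift-by-1 = ℤ-Ring.solve-∀
  helper : Dec (b ≤ 1) → Dec (a ≤ 1) → + (2 ^ (b + a)) ℤ.∣ + p ℤ.- + q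
  helper (yes b≤1) _ = ℤ.∣-trans (ℤ.∣ᵤ⇒∣ (^-monoʳ-∣ 2 (+-monoˡ-≤ a b≤1))) 2^1+a∣
  helper (no _) (yes a≤1) =
    ℤ.∣-trans (ℤ.∣ᵤ⇒∣ (^-monoʳ-∣ 2 (subst (b + a ≤_) (+-comm b 1) (+-monoʳ-≤ b a≤1)))) 2^1+b∣
  -- The balance carries the bound on v₂(p + 1) over to q + 1, so 4 would divide both q - 1 and q +
  -- 1.
  helper (no b≰1) (no a≰1) = contradiction 4∣2 (>⇒∤ (s≤s (s≤s (s≤s z≤n))))
    where
    4∣q-1 : 4 ∣ pred q
    4∣q-1 = ∣-trans (^-monoʳ-∣ 2 (≰⇒> a≰1)) (2^val∣ (pred q))
    4∣q+1 : 4 ∣ q + 1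
    4∣q+1 = ∣-trans (^-monoʳ-∣ 2 (subst (2 ≤_) b≡ (≰⇒> b≰1))) (2^val∣ (q + 1))
    4∣2 : 4 ∣ 2
    4∣2 = ∣m+n∣m⇒∣n (subst (4 ∣_) (trans (cong (_+ 1) (sym (suc-pred q))) (sym (+-suc (pred q) 1))) 4∣q+1) 4∣q-1

2^1+val+val∤* : ∀ m n .{{_ : NonZero m}} .{{_ : NonZero n}} → 2 ^ suc (val 2 m + val 2 n) ∤ m * n
2^1+val+val∤* m n h with split {2} (s≤s (s≤s z≤n)) m | split {2} (s≤s (s≤s z≤n)) n
... | x , j , refl , 2∤x | y , k , refl , 2∤y = 1+n≰n (^∣⇒≤exponent {j = suc (j + k)} (j + k) prime[2] (2∤*⇒ 2∤x 2∤y)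
  (subst₂ _∣_ (cong₂ (λ a b → 2 ^ suc (a + b)) (val-*^ j {{m*n≢0⇒m≢0 x}} (s≤s (s≤s z≤n)) 2∤x)
                                                (val-*^ k {{m*n≢0⇒m≢0 y}} (s≤s (s≤s z≤n)) 2∤y)) rearrange h))
  where
  open ≡-Reasoning
  rearrange : x * 2 ^ j * (y * 2 ^ k) ≡ x * y * 2 ^ (j + k)
  rearrange = begin
    x * 2 ^ j * (y * 2 ^ k)   ≡⟨ [m*n]*[o*p]≡[m*o]*[n*p] x (2 ^ j) y (2 ^ k) ⟩
    x * y * (2 ^ j * 2 ^ k)   ≡⟨ cong (x * y *_) (^-distribˡ-+-* 2 j k) ⟨
    x * y * 2 ^ (j + k)       ∎

-- The power 2^(b+a) divides the GCD and is the exact power of 2 in (p + 1)(q - 1), which leaves no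
-- factor 2 for Pw_p.
balancedProduct⇒¬allPwEven : ∀ {p q} → Prime p → Prime q → p ≢ q → 2 ∤ p → 2 ∤ q →
  val 2 (p ∸ 1) ≡ val 2 (q ∸ 1) → val 2 (p + 1) ≡ val 2 (q + 1) →
  ¬ AllPwEven (1 * q ^ 1 * p ^ 1) C⟨ 1 * q ^ 1 * p ^ 1 ⟩
balancedProduct⇒¬allPwEven {p} {q} pr qr p≢q 2∤p 2∤q a≡ b≡ even =
  2^1+val+val∤* (p + 1) (pred q) (∣-trans (*-monoʳ-∣ 2 2^∣GCD)
    (subst (2 * GCD N C⟨ N ⟩ ∣_) (cong₂ _*_ (+-comm 1 p) totients≡) (2GCD∣ M 0 pr p∤M (prime∤1 prime[2]) even)))
  where
  open ≡-Reasoning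
  M = 1 * q ^ 1
  N = M * p ^ 1
  a b : ℕ
  a = val 2 (pred q)
  b = val 2 (p + 1)
  instance
    p≢0 : NonZero p
    p≢0 = prime⇒nonZero pr
    q≢0 : NonZero q
    q≢0 = prime⇒nonZero qr
    p-1≢0 : NonZero (pred p)
    p-1≢0 = pred≢0 pr
    q-1≢0 : NonZero (pred q)
    q-1≢0 = pred≢0 qr
    p+1≢0 : NonZero (p + 1)
    p+1≢0 = >-nonZero (m≤n+m 1 p)
    q+1≢0 : NonZero (q + 1)
    q+1≢0 = >-nonZero (m≤n+m 1 q)
    _ = m^n≢0 p 1
    _ = m^n≢0 q 1
    M≢0 : NonZero M
    M≢0 = m*n≢0 1 (q ^ 1)
    N≢0 : NonZero N
    N≢0 = m*n≢0 M (p ^ 1)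
  M≡q : M ≡ q
  M≡q = trans (*-identityˡ (q ^ 1)) (^-identityʳ q)
  p∤M : p ∤ M
  p∤M p∣M = p≢q (prime∣prime⇒≡ pr qr (subst (p ∣_) M≡q p∣M))
  1<N : 1 < N
  1<N = <-≤-trans (subst (1 <_) (sym (^-identityʳ p)) (prime>1 pr)) (m≤n*m (p ^ 1) M)
  totients≡ : totients (primeDivisors M) ≡ pred q
  totients≡ = trans (totients-↭ (primeDivisors-*^ 0 qr (prime∤1 qr))) (*-identityʳ (pred q))
  ω≡2 : ω N ≡ 2
  ω≡2 = trans (ω-* M 0 pr p∤M) (cong suc (ω-* 1 0 qr (prime∤1 qr)))
  ones : AllExponents1 N
  ones = exponents1-∷ M pr p∤M (exponents1-∷ 1 qr (prime∤1 qr) λ ())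
  2^b∣p+1 : 2 ^ b ∣ suc p
  2^b∣p+1 = subst (2 ^ b ∣_) (+-comm p 1) (2^val∣ (p + 1))
  2^b∣q+1 : 2 ^ b ∣ suc q
  2^b∣q+1 = subst₂ (λ v n → 2 ^ v ∣ n) (sym b≡) (+-comm q 1) (2^val∣ (q + 1))
  2^a∣p-1 : 2 ^ a ∣ pred p
  2^a∣p-1 = subst (λ v → 2 ^ v ∣ pred p) a≡ (2^val∣ (pred p))
  2^b+a∣* : ∀ {x y} → 2 ^ b ∣ x → 2 ^ a ∣ y → 2 ^ (b + a) ∣ x * y
  2^b+a∣* {x} {y} 2^b∣x 2^a∣y = subst (_∣ x * y) (sym (^-distribˡ-+-* 2 b a)) (*-pres-∣ 2^b∣x 2^a∣y)
  -- Since p q - 1 = (p + 1)(q - 1) + (p - q), the closeness of p and q yields the condition on N.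
  N-1≡ : + (suc p * pred q) ℤ.+ (+ p ℤ.- + q) ≡ + N ℤ.- -1ℤ ℤ.^ ω N
  N-1≡ = begin
    + (suc p * pred q) ℤ.+ (+ p ℤ.- + q)
      ≡⟨ cong (λ z → z ℤ.+ (+ p ℤ.- + q)) (ℤ.pos-* (suc p) (pred q)) ⟩
    + suc p ℤ.* + pred q ℤ.+ (+ p ℤ.- + q)
      ≡⟨ subst (λ n → + suc p ℤ.* + pred q ℤ.+ (+ p ℤ.- + n) ≡ + n ℤ.* + p ℤ.- 1ℤ) (suc-pred q)
           (expand (+ p) (+ pred q)) ⟩
    + q ℤ.* + p ℤ.- 1ℤ
      ≡⟨ cong (λ z → z ℤ.- 1ℤ) (ℤ.pos-* q p) ⟨
    + (q * p) ℤ.- 1ℤ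
      ≡⟨ cong₂ (λ x t → + x ℤ.- -1ℤ ℤ.^ t) (cong₂ _*_ M≡q (^-identityʳ p)) ω≡2 ⟨
    + N ℤ.- -1ℤ ℤ.^ ω N ∎
    where
    expand : ∀ p m → (1ℤ ℤ.+ p) ℤ.* m ℤ.+ (p ℤ.- (1ℤ ℤ.+ m)) ≡ (1ℤ ℤ.+ m) ℤ.* p ℤ.- 1ℤ
    expand = ℤ-Ring.solve-∀
  at : ∀ {r} → r ∈ primeDivisors N → + (2 ^ (b + a)) ℤ.∣ + (r ^ 2) ℤ.- 1ℤ
  at r∈ with ∈-resp-↭ (primeDivisors-*^ 0 pr p∤M) r∈
  ... | here refl = ∣p²-1⇒ p (2^b+a∣* 2^b∣p+1 2^a∣p-1)
  ... | there r∈M with ∈-resp-↭ (primeDivisors-*^ 0 qr (prime∤1 qr)) r∈M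
  ...   | here refl = ∣p²-1⇒ q (2^b+a∣* 2^b∣q+1 (2^val∣ (pred q)))
  2^∣GCD : 2 ^ (b + a) ∣ GCD N C⟨ N ⟩
  2^∣GCD = ∣GCD⁺ 1<N (conditions⇒commonDivisor N ones
    ( subst (+ (2 ^ (b + a)) ℤ.∣_) N-1≡
        (ℤ.∣m∣n⇒∣m+n (ℤ.∣ᵤ⇒∣ {i = + (suc p * pred q)} (2^b+a∣* 2^b∣p+1 (2^val∣ (pred q))))
                     (balanced⇒2^∣ pr qr 2∤p 2∤q a≡ b≡))
    , at ))

𝔥Is2⇒¬allPwEven : ∀ {N} → 𝔥Is2 N → ¬ AllPwEven N C⟨ N ⟩
𝔥Is2⇒¬allPwEven {N} (inj₁ pr) even = prime⇒¬allPwEven pr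
  (subst (λ N → AllPwEven N C⟨ N ⟩) (sym (trans (*-identityˡ (N ^ 1)) (^-identityʳ N))) even)
𝔥Is2⇒¬allPwEven (inj₂ (inj₁ (zero  , 2∤0 , _))) = contradiction (2 ∣0) 2∤0
𝔥Is2⇒¬allPwEven (inj₂ (inj₁ (suc r , 2∤1+r , refl))) even = oddPowerOf2⇒¬allPwEven r 2∤1+r
  (subst (λ N → AllPwEven N C⟨ N ⟩) (sym (*-identityˡ (2 ^ suc r))) even)
𝔥Is2⇒¬allPwEven (inj₂ (inj₂ (inj₁ (p , q , pr , qr , p≢q , 2∤p , 2∤q , refl , a≡ , b≡)))) even =
  balancedProduct⇒¬allPwEven pr qr p≢q 2∤p 2∤q a≡ b≡ (subst (λ N → AllPwEven N C⟨ N ⟩) N≡ even)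
  where
  N≡ : p * q ≡ 1 * q ^ 1 * p ^ 1
  N≡ = trans (*-comm p q) (sym (cong₂ _*_ (trans (*-identityˡ (q ^ 1)) (^-identityʳ q)) (^-identityʳ p)))
𝔥Is2⇒¬allPwEven (inj₂ (inj₂ (inj₂ (p , pr , p%4≡1 , refl)))) even = 4*prime⇒¬allPwEven pr p%4≡1
  (subst (λ N → AllPwEven N C⟨ N ⟩) (cong (4 *_) (sym (^-identityʳ p))) even)

𝔥ᶜ≡𝔥 : ∀ N → 1 < N → 𝔥ᶜ N C⟨ N ⟩ ≡ 𝔥 N
𝔥ᶜ≡𝔥 N 1<N = helper (𝔥Is2? N)
  where
  helper : Dec (𝔥Is2 N) → 𝔥ᶜ N C⟨ N ⟩ ≡ 𝔥 N
  helper (yes is2) = trans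
    (cong (λ b → if b then 1 else 2) (dec-false (allPwEven? N C⟨ N ⟩) (𝔥Is2⇒¬allPwEven is2)))
    (sym (cong (λ b → if b then 2 else 1) (dec-true (𝔥Is2? N) is2)))
  helper (no ¬is2) = trans
    (cong (λ b → if b then 1 else 2) (dec-true (allPwEven? N C⟨ N ⟩) (¬𝔥Is2⇒allPwEven N 1<N ¬is2)))
    (sym (cong (λ b → if b then 2 else 1) (dec-false (𝔥Is2? N) ¬is2)))

theorem3p17 : ∀ (N : ℕ) → 1 < N → GCD N C⟨ N ⟩ ≡ 𝔤 N × 𝔥ᶜ N C⟨ N ⟩ ≡ 𝔥 N
theorem3p17 N 1<N = GCD≡𝔤 N 1<N , 𝔥ᶜ≡𝔥 N 1<N
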